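{- Let $l\ge2$ and let $L_{rel}$, $\mathbf{C}_n$ and the probability measure $\delta_n^{\mathbf{C}}$ on $\mathbf{C}_n$ be as in the context. For every $l$-colour compatible extension axiom $\varphi$, $\lim_{n\to\infty}\delta_n^{\mathbf{C}}(\varphi)=1$, where $\delta_n^{\mathbf{C}}(\varphi)=\delta_n^{\mathbf{C}}(\{\mathcal{M}\in\mathbf{C}_n:\mathcal{M}\models\varphi\})$.
   Context: $l\ge2$ is a fixed integer. $L_{rel}$ is a first-order language with finite nonempty relational vocabulary, all symbols of arity at least $2$. $L$ has in addition new unary relation symbols $P_1,\ldots,P_l$; an element has colour $i$ if it satisfies $P_i$. $\mathbf{K}_n$ is the set of all $L$-structures $\mathcal{M}$ with universe $\{1,\ldots,n\}$ such that every element has exactly one colour and whenever $R$ is a relation symbol of $L_{rel}$ and $\mathcal{M}\models R(a_1,\ldots,a_m)$, at least two of the $a_i$ have different colours. $\mathbf{C}_n=\{\mathcal{M}\upharpoonright L_{rel}:\mathcal{M}\in\mathbf{K}_n\}$. An $l$-colouring of an $L_{rel}$-structure $\mathcal{M}$ is a function $\gamma:M\to\{1,\ldots,l\}$ such that no tuple in any $R^{\mathcal{M}}$ has all its entries of the same colour; $\mathcal{M}$ is $l$-colourable if it has one (similarly with $l-1$). Measure: for $\mathcal{M}\in\mathbf{K}_n$ and $d\in\mathbb{N}$, $\mathcal{M}\upharpoonright d$ is the $L$-structure with the same universe in which $\bar a\in R^{\mathcal{M}\upharpoonright d}$ iff $\bar a\in R^{\mathcal{M}}$ and at most $d$ distinct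 elements occur in $\bar a$, for each relation symbol $R$ of $L$. $\mathbf{K}_n\upharpoonright d=\{\mathcal{M}\upharpoonright d:\mathcal{M}\in\mathbf{K}_n\}$. $\mathbb{P}_{n,0}$ is uniform on $\mathbf{K}_n\upharpoonright0$ and, for $\mathcal{B}\in\mathbf{K}_n\upharpoonright(r+1)$, $\mathbb{P}_{n,r+1}(\mathcal{B})=\mathbb{P}_{n,r}(\mathcal{B}\upharpoonright r)\big/\big|\{\mathcal{B}'\in\mathbf{K}_n\upharpoonright(r+1):\mathcal{B}'\upharpoonright r=\mathcal{B}\upharpoonright r\}\big|$. $\delta^{\mathbf{K}}_n=\mathbb{P}_{n,\rho}$ with $\rho$ the largest arity of a relation symbol. For $\mathbf{Y}\subseteq\mathbf{C}_n$, $\delta_n^{\mathbf{C}}(\mathbf{Y})=\delta_n^{\mathbf{K}}(\{\mathcal{M}\in\mathbf{K}_n:\mathcal{M}\upharpoonright L_{rel}\in\mathbf{Y}\})$. $l$-colour compatible extension axioms: Fix an $l$-colourable $L_{rel}$-structure $\mathcal{S}$ with universe $\{1,\ldots,s\}$, $s\ge3$, such that every $l$-colouring of $\mathcal{S}$ gives $s-1$ and $s$ the same colour, and for every colour $i$ there is an $l$-colouring of $\mathcal{S}$ giving both $s-1$ and $s$ the colour $i$ (such $\mathcal{S}$ exists). For a finite structure $\mathcal{D}$ with universe $\{1,\ldots,d\}$, $\chi_{\mathcal{D}}(x_1,\ldots,x_d)$ is a quantifier-free $L_{rel}$-formula such that $\mathcal{M}\models\chi_{\mathcal{D}}(a_1,\ldots,a_d)$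 iff $a_i\mapsto i$ is an isomorphism from $\mathcal{M}\upharpoonright\{a_1,\ldots,a_d\}$ to $\mathcal{D}$. Let $\xi(y,z)$ be $y=z\vee\exists u_1,\ldots,u_{s-2}\,\chi_{\mathcal{S}}(u_1,\ldots,u_{s-2},y,z)$. Fix an $l$-colourable but not $(l-1)$-colourable $L_{rel}$-structure $\mathcal{U}$ with universe $\{1,\ldots,u\}$ such that $l$ divides $u$ and every partition of the universe into $l$ parts of equal size gives an $l$-colouring of $\mathcal{U}$ (such $\mathcal{U}$ exists), and fix an $l$-colouring of $\mathcal{U}$ in which $1,\ldots,l$ have different colours. Let $I$ be the set of unordered pairs $\{i,j\}\subseteq\{1,\ldots,u\}$ with $i,j$ of the same colour in it, and let $\zeta(x_1,\ldots,x_u)$ be $\chi_{\mathcal{U}}(x_1,\ldots,x_u)\wedge\bigwedge_{\{i,j\}\in I}\xi(x_i,x_j)\wedge\bigwedge_{\{i,j\}\notin I}\neg\xi(x_i,x_j)$. Let $\mathcal{B}$ be a finite $l$-colourable $L_{rel}$-structure and $\mathcal{A}$ a proper substructure, with $A=\{1,\ldots,\alpha\}$, $B=\{1,\ldots,\beta\}$. For an $l$-colouring $\gamma'$ of $\mathcal{B}$ with restriction $\gamma=\gamma'\upharpoonright A$, and a permutation $\tau$ of $\{1,\ldots,l\}$, let $\theta_{\gamma,\tau}(x_1,\ldots,x_l,y_1,\ldots,y_\alpha)=\bigwedge_{j=1}^{\alpha}\xi(x_{\tau(\gamma(j))},y_j)$ and $\theta_{\gamma',\tau}(x_1,\ldots,x_l,y_1,\ldots,y_\beta)=\bigwedge_{j=1}^{\beta}\xi(x_{\tau(\gamma'(j))},y_j)$.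 The corresponding instance is the sentence $$\forall x_1,\ldots,x_u,y_1,\ldots,y_\alpha\,\exists y_{\alpha+1},\ldots,y_\beta\big([\zeta(\bar x)\wedge\chi_{\mathcal{A}}(y_1,\ldots,y_\alpha)\wedge\theta_{\gamma,\tau}]\to[\chi_{\mathcal{B}}(y_1,\ldots,y_\beta)\wedge\theta_{\gamma',\tau}]\big)$$ (if $A=\emptyset$, the conjuncts $\chi_{\mathcal{A}},\theta_{\gamma,\tau}$ are omitted). The $l$-colour compatible $\mathcal{B}/\mathcal{A}$-extension axiom is the conjunction of all its (finitely many) instances over all $\gamma',\tau$. -}

module Defs where

open import Data.Bool using (Bool; true; false; T; _∧_)
open import Data.Bool.Properties using (T?) renaming (_≟_ to _≟ᴮ_)
open import Data.Fin using (Fin; zero; suc; _↑ˡ_; _↑ʳ_; inject≤; _<?_)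
open import Data.Fin.Properties using (any?; all?) renaming (_≟_ to _≟ᶠ_)
open import Data.Integer using (+_)
open import Data.List as List
  using (List; []; _∷_; filter; deduplicate; length; cartesianProduct; cartesianProductWith)
  renaming (_++_ to _++ᴸ_)
open import Data.List.Extrema.Nat using (max)
open import Data.List.Membership.Propositional using (_∈_)
open import Data.List.Membership.Propositional.Properties using (∈-++⁺ʳ)
open import Data.List.Relation.Unary.All as All using (All; []; _∷_)
open import Data.List.Relation.Unary.All.Properties using (++⁻ˡ)
open import Data.List.Relation.Unary.Any using (here; there)
open import Data.Nat as ℕ using (ℕ; zero; suc; pred; _+_; _≤_; _≤?_)
open import Data.Nat.Divisibility using (_∣_)
open import Data.Product using (Σ; ∃; ∃!; ∃-syntax; _×_; _,_; proj₁; proj₂; uncurry)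
open import Data.Rational as ℚ using (ℚ; 0ℚ; 1ℚ; _/_)
open import Data.Sum using (_⊎_)
open import Data.Unit using (⊤; tt)
open import Data.Vec as Vec using (Vec; []; _∷_; lookup; tabulate; toList; count)
  renaming (_++_ to _++ⱽ_)
open import Data.Vec.Properties using (≡-dec)
open import Data.Vec.Relation.Unary.Unique.Propositional using (Unique)
open import Data.Vec.Relation.Unary.AllPairs using (allPairs?)
open import Function using (_∘_; _⇔_)
open import Level using (0ℓ)
open import Relation.Binary.Definitions using (DecidableEquality)
open import Relation.Binary.PropositionalEquality using (_≡_; _≢_; refl; cong₂)
open import Relation.Nullary
  using (¬_; Dec; yes; no; does; ¬?; _×-dec_; _⊎-dec_; _→-dec_)
open import Relation.Nullary.Decidable using (map′)
open import Relation.Unary using (Pred; Decidable)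

------------------------------------------------------------------------
-- Enumerations and decision procedures

vecs : {A : Set} → List A → ∀ m → List (Vec A m)
vecs as zero    = [] ∷ []
vecs as (suc m) = cartesianProductWith _∷_ as (vecs as m)

allVec? : ∀ {n m} {P : Pred (Vec (Fin n) m) 0ℓ} → Decidable P → Dec (∀ a → P a)
allVec? {m = zero}  P? = map′ (λ { p [] → p }) (λ p → p []) (P? [])
allVec? {m = suc m} P? =
  map′ (λ { p (x ∷ a) → p x a }) (λ p x a → p (x ∷ a))
       (all? λ x → allVec? λ a → P? (x ∷ a))

------------------------------------------------------------------------
-- Relational vocabularies and finite structures

-- A finite relational vocabulary is the list of arities of its symbols;
-- an element of  m ∈ V  is a relation symbol of arity m.
Vocabulary : Set
Vocabulary = List ℕ

symbols : (V : Vocabulary) → List (∃[ m ] m ∈ V)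
symbols []      = []
symbols (m ∷ V) = (m , here refl) ∷ List.map (λ (k , R) → k , there R) (symbols V)

allSymbol? : ∀ {V : Vocabulary} {P : ∀ {m} → m ∈ V → Set} →
             (∀ {m} (R : m ∈ V) → Dec (P R)) → Dec (∀ {m} (R : m ∈ V) → P R)
allSymbol? {[]}            P? = yes λ ()
allSymbol? {_ ∷ V} {P = P} P? = map′ to from (P? (here refl) ×-dec allSymbol? (λ R → P? (there R)))
  where
  to : P (here refl) × (∀ {m} (R : m ∈ V) → P (there R)) → ∀ {m} (R : m ∈ _ ∷ V) → P R
  to (p , q) (here refl) = p
  to (p , q) (there R)   = q R

  from : (∀ {m} (R : m ∈ _ ∷ V) → P R) → P (here refl) × (∀ {m} (R : m ∈ V) → P (there R))
  from p = p (here refl) , λ R → p (there R)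

-- The m-ary relations on Fin n, stored as truth tables: propositional equality
-- is then extensional equality, so that sets of structures can be counted.
Relation : ℕ → ℕ → Set
Relation n zero    = Bool
Relation n (suc m) = Vec (Relation n m) n

lookupᴿ : ∀ {n m} → Relation n m → Vec (Fin n) m → Bool
lookupᴿ r []      = r
lookupᴿ r (x ∷ a) = lookupᴿ (lookup r x) a

tabulateᴿ : ∀ {n m} → (Vec (Fin n) m → Bool) → Relation n m
tabulateᴿ {m = zero}  f = f []
tabulateᴿ {m = suc m} f = tabulate λ x → tabulateᴿ λ a → f (x ∷ a)

-- The universe {1,…,n} is Fin n.
Structure : Vocabulary → ℕ → Set
Structure V n = All (Relation n) V

module _ {V : Vocabulary} {n : ℕ} where

  Holds : Structure V n → ∀ {m} → m ∈ V → Vec (Fin n) m → Set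
  Holds M R a = T (lookupᴿ (All.lookup M R) a)

  holds? : ∀ (M : Structure V n) {m} (R : m ∈ V) → Decidable (Holds M R)
  holds? M R a = T? (lookupᴿ (All.lookup M R) a)

_≟ᴿ_ : ∀ {n m} → DecidableEquality (Relation n m)
_≟ᴿ_ {m = zero}  = _≟ᴮ_
_≟ᴿ_ {m = suc m} = ≡-dec _≟ᴿ_

_≟ˢ_ : ∀ {V n} → DecidableEquality (Structure V n)
[]      ≟ˢ []      = yes refl
(r ∷ M) ≟ˢ (s ∷ N) =
  map′ (uncurry (cong₂ _∷_)) (λ { refl → refl , refl }) (r ≟ᴿ s ×-dec M ≟ˢ N)

module _ {V : Vocabulary} {n : ℕ} where
  open import Data.List.Membership.DecPropositional (_≟ˢ_ {V} {n}) public using (_∈?_)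

relations : ∀ n m → List (Relation n m)
relations n zero    = true ∷ false ∷ []
relations n (suc m) = vecs (relations n m) n

-- Every structure occurs exactly once in this list.
structures : ∀ V n → List (Structure V n)
structures []      n = [] ∷ []
structures (m ∷ V) n = cartesianProductWith _∷_ (relations n m) (structures V n)

-- The initial segment {1,…,α} of {1,…,α+k} carries the substructure.
IsSubstructure : ∀ {V α k} → Structure V α → Structure V (α + k) → Set
IsSubstructure {V} {α} {k} A B =
  ∀ {m} (R : m ∈ V) (a : Vec (Fin α) m) → Holds A R a ⇔ Holds B R (Vec.map (_↑ˡ k) a)

------------------------------------------------------------------------
-- Colourings

IsColouring : ∀ {V n c} → Structure V n → Vec (Fin c) n → Set
IsColouring {V} {n} M γ = ∀ {m} (R : m ∈ V) (a : Vec (Fin n) m) → Holds M R a →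
  ¬ (∀ p q → lookup γ (lookup a p) ≡ lookup γ (lookup a q))

isColouring? : ∀ {V n c} (M : Structure V n) → Decidable (IsColouring {c = c} M)
isColouring? M γ = allSymbol? λ R → allVec? λ a → holds? M R a →-dec
  ¬? (all? λ p → all? λ q → lookup γ (lookup a p) ≟ᶠ lookup γ (lookup a q))

Colourable : ∀ {V n} → ℕ → Structure V n → Set
Colourable {n = n} c M = ∃[ γ ] IsColouring {c = c} M γ

colourings : ∀ {V n} l → Structure V n → List (Vec (Fin l) n)
colourings {n = n} l M = filter (isColouring? M) (vecs (List.allFin l) n)

------------------------------------------------------------------------
-- First-order formulas with free variables in Fin k.
-- A quantifier binds the variable zero; the variables already in scope are shifted.

infixr 7 _∧ᶠ_
infixr 6 _∨ᶠ_
infixr 5 _⇒ᶠ_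
infix  8 ¬ᶠ_ _≐_

data Formula (V : Vocabulary) (k : ℕ) : Set where
  ⊤ᶠ             : Formula V k
  _≐_            : Fin k → Fin k → Formula V k
  rel            : ∀ {m} → m ∈ V → Vec (Fin k) m → Formula V k
  ¬ᶠ_            : Formula V k → Formula V k
  _∧ᶠ_ _∨ᶠ_ _⇒ᶠ_ : Formula V k → Formula V k → Formula V k
  ∀ᶠ ∃ᶠ          : Formula V (suc k) → Formula V k

Sentence : Vocabulary → Set
Sentence V = Formula V 0

_⊨_[_] : ∀ {V n k} → Structure V n → Formula V k → Vec (Fin n) k → Set
M ⊨ ⊤ᶠ      [ e ] = ⊤
M ⊨ x ≐ y   [ e ] = lookup e x ≡ lookup e y
M ⊨ rel R x [ e ] = Holds M R (Vec.map (lookup e) x)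
M ⊨ ¬ᶠ φ    [ e ] = ¬ (M ⊨ φ [ e ])
M ⊨ φ ∧ᶠ ψ  [ e ] = (M ⊨ φ [ e ]) × (M ⊨ ψ [ e ])
M ⊨ φ ∨ᶠ ψ  [ e ] = (M ⊨ φ [ e ]) ⊎ (M ⊨ ψ [ e ])
M ⊨ φ ⇒ᶠ ψ  [ e ] = (M ⊨ φ [ e ]) → (M ⊨ ψ [ e ])
M ⊨ ∀ᶠ φ    [ e ] = ∀ x → M ⊨ φ [ x ∷ e ]
M ⊨ ∃ᶠ φ    [ e ] = ∃[ x ] M ⊨ φ [ x ∷ e ]

sat? : ∀ {V n k} (M : Structure V n) (φ : Formula V k) e → Dec (M ⊨ φ [ e ])
sat? M ⊤ᶠ        e = yes tt
sat? M (x ≐ y)   e = lookup e x ≟ᶠ lookup e y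
sat? M (rel R x) e = holds? M R (Vec.map (lookup e) x)
sat? M (¬ᶠ φ)    e = ¬? (sat? M φ e)
sat? M (φ ∧ᶠ ψ)  e = sat? M φ e ×-dec sat? M ψ e
sat? M (φ ∨ᶠ ψ)  e = sat? M φ e ⊎-dec sat? M ψ e
sat? M (φ ⇒ᶠ ψ)  e = sat? M φ e →-dec sat? M ψ e
sat? M (∀ᶠ φ)    e = all? λ x → sat? M φ (x ∷ e)
sat? M (∃ᶠ φ)    e = any? λ x → sat? M φ (x ∷ e)

_⊨_ : ∀ {V n} → Structure V n → Sentence V → Set
M ⊨ φ = M ⊨ φ [ [] ]

_⊨?_ : ∀ {V n} (M : Structure V n) (φ : Sentence V) → Dec (M ⊨ φ)
M ⊨? φ = sat? M φ []

⋀ : ∀ {V k} → List (Formula V k) → Formula V k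
⋀ = List.foldr _∧ᶠ_ ⊤ᶠ

-- In the scope of  ∃* m  the m new variables are  i ↑ˡ k  (i : Fin m),
-- and the old variable j : Fin k has become  m ↑ʳ j.
∃* : ∀ {V k} m → Formula V (m + k) → Formula V k
∃* zero    φ = φ
∃* (suc m) φ = ∃* m (∃ᶠ φ)

∀-closure : ∀ {V} k → Formula V k → Sentence V
∀-closure zero    φ = φ
∀-closure (suc k) φ = ∀-closure k (∀ᶠ φ)

------------------------------------------------------------------------
-- The measures

-- L extends V = L_rel by l unary symbols P₁,…,P_l.
L : ℕ → Vocabulary → Vocabulary
L l V = V ++ᴸ List.replicate l 1

P : ∀ {l V} → Fin l → 1 ∈ L l V
P {l} {V} i = ∈-++⁺ʳ V (position i)
  where
  position : ∀ {l} → Fin l → 1 ∈ List.replicate l 1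
  position zero    = here refl
  position (suc i) = there (position i)

HasColour : ∀ {l V n} → Structure (L l V) n → Fin n → Fin l → Set
HasColour {l} {V} M a i = Holds M (P {l} {V} i) (a ∷ [])

hasColour? : ∀ {l V n} (M : Structure (L l V) n) a → Decidable (HasColour {l} {V} M a)
hasColour? {l} {V} M a i = holds? M (P {l} {V} i) (a ∷ [])

-- M ↾ L_rel
reduct : ∀ l V {n} → Structure (L l V) n → Structure V n
reduct l V = ++⁻ˡ V

In𝐊 : ∀ l V n → Pred (Structure (L l V) n) 0ℓ
In𝐊 l V n M =
  (∀ a → ∃! _≡_ (HasColour {l} {V} M a)) ×
  (∀ {m} (R : m ∈ V) (a : Vec (Fin n) m) → Holds (reduct l V M) R a →
    ∃[ p ] ∃[ q ] ∃[ i ] ∃[ j ]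
      (HasColour {l} {V} M (lookup a p) i × HasColour {l} {V} M (lookup a q) j × i ≢ j))

in𝐊? : ∀ l V n → Decidable (In𝐊 l V n)
in𝐊? l V n M =
  (all? λ a → any? λ i → hasColour? {l} {V} M a i ×-dec
    map′ (λ f {j} → f j) (λ f j → f {j})
      (all? λ j → hasColour? {l} {V} M a j →-dec i ≟ᶠ j))
  ×-dec
  (allSymbol? λ R → allVec? λ a → holds? (reduct l V M) R a →-dec
    (any? λ p → any? λ q → any? λ i → any? λ j →
      hasColour? {l} {V} M (lookup a p) i ×-dec
      hasColour? {l} {V} M (lookup a q) j ×-dec ¬? (i ≟ᶠ j)))

-- Finite sets of structures are represented by duplicate-free lists.
𝐊 : ∀ l V n → List (Structure (L l V) n)
𝐊 l V n = filter (in𝐊? l V n) (structures (L l V) n)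

𝐂 : ∀ l V n → List (Structure V n)
𝐂 l V n = deduplicate _≟ˢ_ (List.map (reduct l V) (𝐊 l V n))

-- The number of distinct elements occurring in a tuple.
distinct : ∀ {n m} → Vec (Fin n) m → ℕ
distinct a = length (deduplicate _≟ᶠ_ (toList a))

_↾_ : ∀ {V n} → Structure V n → ℕ → Structure V n
M ↾ d = All.map (λ r → tabulateᴿ λ a → lookupᴿ r a ∧ does (distinct a ≤? d)) M

𝐊↾ : ∀ l V n d → List (Structure (L l V) n)
𝐊↾ l V n d = deduplicate _≟ˢ_ (List.map (_↾ d) (𝐊 l V n))

-- Total division; the convention p ÷ 0 = 0 is not used for arguments in 𝐊↾ below.
_÷_ : ℚ → ℕ → ℚ
p ÷ zero  = 0ℚ
p ÷ suc k = p ℚ.* (+ 1 / suc k)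

-- The point masses of ℙ_{n,r}; only the values at elements of 𝐊↾ l V n r are meaningful.
ℙ : ∀ l V n (r : ℕ) → Structure (L l V) n → ℚ
ℙ l V n zero    B = 1ℚ ÷ length (𝐊↾ l V n 0)
ℙ l V n (suc r) B =
  ℙ l V n r (B ↾ r) ÷ length (filter (λ B′ → (B′ ↾ r) ≟ˢ (B ↾ r)) (𝐊↾ l V n (suc r)))

ρ : Vocabulary → ℕ
ρ V = max 0 V

sumℚ : List ℚ → ℚ
sumℚ = List.foldr ℚ._+_ 0ℚ

-- The measure of {M ∈ 𝐊 | X M}; note 𝐊↾ρ = 𝐊.
δᴷ : ∀ l V n {X : Pred (Structure (L l V) n) 0ℓ} → Decidable X → ℚ
δᴷ l V n X? = sumℚ (List.map (ℙ l V n (ρ (L l V))) (filter X? (𝐊 l V n)))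

δᶜ : ∀ l V n {Y : Pred (Structure V n) 0ℓ} → Decidable Y → ℚ
δᶜ l V n Y? = δᴷ l V n (Y? ∘ reduct l V)

-- δᶜ_n (φ) = δᶜ_n ({M ∈ 𝐂_n | M ⊨ φ})
δᶜ-sentence : ∀ l V → Sentence V → ℕ → ℚ
δᶜ-sentence l V φ n = δᶜ l V n (λ M → (M ∈? 𝐂 l V n) ×-dec (M ⊨? φ))

-- Convergence of rational sequences to a rational limit.
_⟶_ : (ℕ → ℚ) → ℚ → Set
f ⟶ q = ∀ ε → 0ℚ ℚ.< ε → ∃[ N ] (∀ n → N ≤ n → ℚ.∣ f n ℚ.- q ∣ ℚ.< ε)

------------------------------------------------------------------------
-- Colour compatible extension axioms

-- χ D x says that  xᵢ ↦ i  is a well-defined isomorphism from the substructure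
-- on the interpretation of the variables x onto D.
χ : ∀ {V d k} → Structure V d → Vec (Fin k) d → Formula V k
χ {V} {d} D x =
  ⋀ (List.map (λ (i , j) → ¬ᶠ (lookup x i ≐ lookup x j))
       (filter (λ (i , j) → i <? j) (cartesianProduct (List.allFin d) (List.allFin d))))
  ∧ᶠ
  ⋀ (List.concatMap (λ (m , R) → List.map (literal R) (vecs (List.allFin d) m)) (symbols V))
  where
  literal : ∀ {m} → m ∈ V → Vec (Fin d) m → Formula V _
  literal R a with holds? D R a
  ... | yes _ = rel R (Vec.map (lookup x) a)
  ... | no  _ = ¬ᶠ rel R (Vec.map (lookup x) a)

-- The structures 𝒮 and 𝒰, with their colour data, from which ξ and ζ are built.
-- The universe of 𝒮 has size s = r + 2, so that s-1 and s are  r ↑ʳ 0, r ↑ʳ 1.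
record ColourGadgets (l : ℕ) (V : Vocabulary) : Set where
  field
    r            : ℕ
    3≤s          : 3 ≤ r + 2
    𝒮            : Structure V (r + 2)
    𝒮-colourable : Colourable l 𝒮
    𝒮-same       : ∀ (γ : Vec (Fin l) (r + 2)) → IsColouring 𝒮 γ →
                   lookup γ (r ↑ʳ zero) ≡ lookup γ (r ↑ʳ suc zero)
    𝒮-every      : ∀ (i : Fin l) → ∃[ γ ] (IsColouring 𝒮 γ ×
                   lookup γ (r ↑ʳ zero) ≡ i × lookup γ (r ↑ʳ suc zero) ≡ i)

    u              : ℕ
    𝒰              : Structure V u
    𝒰-colourable   : Colourable l 𝒰
    𝒰-uncolourable : ¬ Colourable (pred l) 𝒰
    l∣u            : l ∣ u
    𝒰-partitions   : ∀ (γ : Vec (Fin l) u) →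
                     (∀ i j → count (i ≟ᶠ_) γ ≡ count (j ≟ᶠ_) γ) → IsColouring 𝒰 γ

    κ           : Vec (Fin l) u
    κ-colouring : IsColouring 𝒰 κ
    -- Follows from the other fields when l ≥ 2; needed to name 1,…,l in the universe of 𝒰.
    l≤u         : l ≤ u
    κ-distinct  : ∀ (i j : Fin l) →
                  lookup κ (inject≤ i l≤u) ≡ lookup κ (inject≤ j l≤u) → i ≡ j

module _ {l : ℕ} {V : Vocabulary} (G : ColourGadgets l V) where
  open ColourGadgets G

  ξ : ∀ {k} → Fin k → Fin k → Formula V k
  ξ {k} y z = y ≐ z ∨ᶠ
    ∃* r (χ 𝒮 (Vec.map (_↑ˡ k) (Vec.allFin r) ++ⱽ (r ↑ʳ y) ∷ (r ↑ʳ z) ∷ []))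

  ζ : ∀ {k} → Vec (Fin k) u → Formula V k
  ζ x = χ 𝒰 x
    ∧ᶠ ⋀ (List.map (λ (i , j) → ξ (lookup x i) (lookup x j)) (filter same? pairs))
    ∧ᶠ ⋀ (List.map (λ (i , j) → ¬ᶠ ξ (lookup x i) (lookup x j)) (filter (¬? ∘ same?) pairs))
    where
    pairs : List (Fin u × Fin u)
    pairs = filter (λ (i , j) → i <? j) (cartesianProduct (List.allFin u) (List.allFin u))

    same? : Decidable (λ ((i , j) : Fin u × Fin u) → lookup κ i ≡ lookup κ j)
    same? (i , j) = lookup κ i ≟ᶠ lookup κ j

  θ : ∀ {k d} → Vec (Fin l) d → Vec (Fin l) l → Vec (Fin k) l → Vec (Fin k) d → Formula V k
  θ γ τ x y =
    ⋀ (toList (Vec.zipWith (λ c yⱼ → ξ (lookup x (lookup τ c)) yⱼ) γ y))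

  -- The free variables of the matrix are y_{α+1},…,y_{α+k} (bound by ∃*), then x₁,…,x_u, then
  -- y₁,…,y_α.  For α = 0 the formulas χ 𝒜 and θ γ τ are empty conjunctions.
  instanceOf : ∀ {α k} → Structure V α → Structure V (α + k) →
               Vec (Fin l) (α + k) → Vec (Fin l) l → Sentence V
  instanceOf {α} {k} 𝒜 𝓑 γ′ τ =
    ∀-closure (u + α) (∃* k
      ((ζ x ∧ᶠ χ 𝒜 y ∧ᶠ θ (Vec.take α γ′) τ x₁…x_l y)
        ⇒ᶠ (χ 𝓑 y′ ∧ᶠ θ γ′ τ x₁…x_l y′)))
    where
    x : Vec (Fin (k + (u + α))) u
    x = tabulate λ i → k ↑ʳ (i ↑ˡ α)

    x₁…x_l : Vec (Fin (k + (u + α))) l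
    x₁…x_l = tabulate λ i → lookup x (inject≤ i l≤u)

    y : Vec (Fin (k + (u + α))) α
    y = tabulate λ j → k ↑ʳ (u ↑ʳ j)

    y′ : Vec (Fin (k + (u + α))) (α + k)
    y′ = y ++ⱽ tabulate λ j → j ↑ˡ (u + α)

  permutations : List (Vec (Fin l) l)
  permutations = filter unique? (vecs (List.allFin l) l)
    where
    unique? : Decidable (Unique {n = l})
    unique? = allPairs? λ i j → ¬? (i ≟ᶠ j)

  extensionAxiom : ∀ {α k} → Structure V α → Structure V (α + k) → Sentence V
  extensionAxiom 𝒜 𝓑 =
    ⋀ (cartesianProductWith (instanceOf 𝒜 𝓑) (colourings l 𝓑) permutations)

-- An l-colour compatible extension axiom: 𝒜 is a proper substructure of the
-- l-colourable 𝓑, whose universes have sizes α < β = α + k.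
data IsExtensionAxiom {l V} (G : ColourGadgets l V) : Sentence V → Set where
  extension : ∀ {α k} (𝒜 : Structure V α) (𝓑 : Structure V (α + k)) →
              1 ≤ k → Colourable l 𝓑 → IsSubstructure 𝒜 𝓑 →
              IsExtensionAxiom G (extensionAxiom G 𝒜 𝓑)

{-# OPTIONS --safe #-}
-- A K-structure is a colouring γ together with arbitrary relations N from which the
-- γ-monochromatic tuples have been removed.  The number of N yielding a given structure
-- depends on γ only, so ℙ is the image of the uniform distribution on all pairs (γ , N),
-- and δᶜ becomes a quotient of cardinalities.
--
-- For the extension axioms, fix the values y of the old variables and m disjoint blocks of
-- candidates for the new ones.  Overwriting the colours and relations on one block with the
-- required ones does not affect the other blocks, and it is injective once the overwritten
-- data, of bounded size, are remembered.  So each block multiplies the number of pairs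
-- without a good block by at most a constant q/(q+1) < 1, which beats the polynomially many
-- choices of y.  Applied to 𝒮, this makes ξ define "same colour" almost surely: the converse
-- implication holds because 𝒮 forces equal colours.  Then x₁,…,x_l represent the l colours,
-- and the same count applied to 𝓑 yields the extensions.
module Submission where

open import Data.Bool using (Bool; true; false; T; _∧_; not; if_then_else_)
open import Data.Bool.Properties using (∧-zeroʳ; ∧-identityʳ) renaming (_≟_ to _≟ᴮ_)
open import Data.Empty using (⊥-elim)
open import Data.Fin as Fin using (Fin; zero; suc; inject≤; combine; _↑ˡ_; _↑ʳ_; _<?_)
open import Data.Fin.Properties as Fin
  using (any?; all?; ¬∀⟶∃¬; combine-injective; inject≤-injective)
  renaming (_≟_ to _≟ᶠ_)
import Data.Integer as ℤ
import Data.Integer.Properties as ℤ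
open import Data.List as List
  using (List; []; _∷_; filter; length; cartesianProduct; deduplicate; replicate)
open import Data.List.Extrema.Nat using (xs≤max)
open import Data.List.Membership.Propositional using (_∈_; find; lose)
open import Data.List.Membership.Propositional.Properties
open import Data.List.Properties
  using (filter-all; filter-none; length-++; length-deduplicate; length-filter; length-map; length-tabulate)
open import Data.List.Relation.Unary.All as All using (All; []; _∷_)
import Data.List.Relation.Unary.All.Properties as All
open import Data.List.Relation.Unary.AllPairs using ([]; _∷_)
open import Data.List.Relation.Unary.Any as Any using (here; there)
import Data.List.Relation.Unary.Unique.DecPropositional.Properties as UniqueDec
import Data.List.Relation.Unary.Unique.Propositional as UniqueList
import Data.List.Relation.Unary.Unique.Propositional.Properties as UniqueList
open import Data.Nat as ℕ
  using (ℕ; zero; suc; _+_; _*_; _^_; _≤_; _<_; _≤?_; z≤n; s≤s; NonZero; nonZero)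
import Data.Nat.DivMod as ℕ
open import Data.Nat.ListAction using (sum)
open import Data.Nat.Properties as ℕ using (module ≤-Reasoning)
open import Data.Nat.Solver using (module +-*-Solver)
open import Data.Product using (Σ; ∃-syntax; _×_; _,_; proj₁; proj₂)
open import Data.Rational as ℚ using (ℚ; mkℚ; 0ℚ; 1ℚ; _/_)
import Data.Rational.Properties as ℚ
import Data.Rational.Unnormalised as ℚᵘ
import Data.Rational.Unnormalised.Properties as ℚᵘ
open import Data.Sum using (_⊎_; inj₁; inj₂)
open import Data.Unit using (tt)
open import Data.Vec as Vec using (Vec; []; _∷_; lookup; tabulate; toList) renaming (_++_ to _++ⱽ_)
import Data.Vec.Membership.Propositional.Properties as Vec
open import Data.Vec.Properties
  using (lookup∘tabulate; tabulate∘lookup; tabulate-cong; ≡-dec; ∷-injective; lookup-++ˡ; lookup-++ʳ;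
         take++drop≡id; lookup-zipWith; lookup-allFin; map-∘; map-cong)
  renaming (lookup-map to lookup-mapⱽ)
import Data.Vec.Relation.Unary.Unique.Propositional.Properties as UniqueVec
open import Function using (_∘_; id; _⇔_; mk⇔; Equivalence)
open import Level using (0ℓ)
open import Relation.Binary.Definitions using (DecidableEquality; tri<; tri≈; tri>)
open import Relation.Binary.PropositionalEquality
  using (_≡_; _≢_; refl; sym; trans; cong; cong₂; subst; subst₂; module ≡-Reasoning)
open import Relation.Nullary
  using (¬_; Dec; yes; no; does; ¬?; _×-dec_; _→-dec_; contradiction)
open import Relation.Nullary.Decidable using (map′; dec-true; dec-false; decidable-stable)
open import Relation.Unary using (Pred; Decidable)
open import Defs

-- In `𝐊` a change of colour may make a tuple of the structure forbidden. In a pair (`γ`, `N`)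
-- colours and relations vary independently and a forbidden tuple merely becomes invisible, so
-- bounded pieces can be rewritten at will. The price is that `ℙ` is defined level by level: the
-- invariant of `ℙ-mask` is that a structure of level `r` has mass proportional to the number of
-- outcomes truncating to it, and its induction step needs equally large fibres over all extensions
-- of one structure. Fibres are compared by injections both ways, without computing their size. The
-- passage from level 0 to level 1 is special, as colours only appear at level 1. The sentences
-- speak of the vocabulary `V` only and see colours up to a permutation. Which colouring of `𝓑` has
-- to be realised is known only once x₁,...,x_l are given, so richness quantifies over all colour
-- patterns. The counting estimates are inequalities between natural numbers; rationals enter only
-- with the masses and the final limit.

private variable
  A B : Set

-- Counting in duplicate-free lists

-- Pigeonhole: delete the image of the head from `ys`; by injectivity the images of the tail survive
-- the deletion.
length-injection : {f : A → B} {xs : List A} {ys : List B} → UniqueList.Unique xs →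
  (∀ {x x′} → x ∈ xs → x′ ∈ xs → f x ≡ f x′ → x ≡ x′) →
  (∀ {x} → x ∈ xs → f x ∈ ys) → length xs ≤ length ys
length-injection {xs = []} _ _ _ = z≤n
length-injection {f = f} {xs = x ∷ xs} {ys} (x∉xs ∷ xs!) f-inj f∈
  with as , bs , refl ← ∈-∃++ (f∈ (here refl)) = begin
    suc (length xs)              ≤⟨ s≤s (length-injection xs! (λ p q → f-inj (there p) (there q)) f∈′) ⟩
    suc (length (as List.++ bs)) ≡⟨ cong suc (length-++ as) ⟩
    suc (length as + length bs)  ≡⟨ ℕ.+-suc (length as) (length bs) ⟨
    length as + suc (length bs)  ≡⟨ length-++ as ⟨
    length (as List.++ f x ∷ bs) ∎
  where
  open ≤-Reasoning
  f∈′ : ∀ {x′} → x′ ∈ xs → f x′ ∈ as List.++ bs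
  f∈′ x′∈ with ∈-++⁻ as (f∈ (there x′∈))
  ... | inj₁ p           = ∈-++⁺ˡ p
  ... | inj₂ (there p)   = ∈-++⁺ʳ as p
  ... | inj₂ (here fx′≡) =
    contradiction (f-inj (here refl) (there x′∈) (sym fx′≡)) (All.lookup x∉xs x′∈)

# : {P : Pred A 0ℓ} → Decidable P → List A → ℕ
# P? xs = length (filter P? xs)

#-injection : {P : Pred A 0ℓ} {Q : Pred B 0ℓ} (P? : Decidable P) (Q? : Decidable Q) {f : A → B} {xs : List A} {ys : List B} →
  UniqueList.Unique xs → (∀ y → y ∈ ys) →
  (∀ {x x′} → P x → P x′ → f x ≡ f x′ → x ≡ x′) →
  (∀ {x} → P x → Q (f x)) → # P? xs ≤ # Q? ys
#-injection P? Q? {f} {xs} xs! ys-complete f-inj f-pres = length-injection {f = f}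
  (UniqueList.filter⁺ P? xs!)
  (λ x∈ x′∈ → f-inj (proj₂ (∈-filter⁻ P? {xs = xs} x∈)) (proj₂ (∈-filter⁻ P? {xs = xs} x′∈)))
  (λ x∈ → ∈-filter⁺ Q? (ys-complete _) (f-pres (proj₂ (∈-filter⁻ P? {xs = xs} x∈))))

#-union : {P Q R : Pred A 0ℓ} (P? : Decidable P) (Q? : Decidable Q) (R? : Decidable R) →
  (∀ x → P x → Q x ⊎ R x) → (xs : List A) → # P? xs ≤ # Q? xs + # R? xs
#-union P? Q? R? P⊆Q∪R [] = z≤n
#-union P? Q? R? P⊆Q∪R (x ∷ xs) with ih ← #-union P? Q? R? P⊆Q∪R xs | P? x | Q? x | R? x
... | no _  | no _  | no _  = ih
... | no _  | no _  | yes _ = ℕ.≤-trans (ℕ.m≤n⇒m≤1+n ih) (ℕ.≤-reflexive (sym (ℕ.+-suc _ _)))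
... | no _  | yes _ | no _  = ℕ.m≤n⇒m≤1+n ih
... | no _  | yes _ | yes _ = ℕ.m≤n⇒m≤1+n (ℕ.≤-trans ih (ℕ.+-monoʳ-≤ _ (ℕ.n≤1+n _)))
... | yes _ | yes _ | no _  = s≤s ih
... | yes _ | yes _ | yes _ = s≤s (ℕ.≤-trans ih (ℕ.+-monoʳ-≤ _ (ℕ.n≤1+n _)))
... | yes _ | no _  | yes _ = ℕ.≤-trans (s≤s ih) (ℕ.≤-reflexive (sym (ℕ.+-suc _ _)))
... | yes p | no ¬q | no ¬r with P⊆Q∪R x p
...   | inj₁ q = contradiction q ¬q
...   | inj₂ r = contradiction r ¬r

#-⊎ : {P Q R : Pred A 0ℓ} (P? : Decidable P) (Q? : Decidable Q) (R? : Decidable R) →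
  (∀ x → P x ⇔ (Q x ⊎ R x)) → (∀ x → Q x → ¬ R x) →
  (xs : List A) → # P? xs ≡ # Q? xs + # R? xs
#-⊎ P? Q? R? P⇔Q∪R disj [] = refl
#-⊎ P? Q? R? P⇔Q∪R disj (x ∷ xs) with ih ← #-⊎ P? Q? R? P⇔Q∪R disj xs | P? x | Q? x | R? x
... | yes p | yes q | yes r = contradiction r (disj x q)
... | yes p | yes q | no ¬r = cong suc ih
... | yes p | no ¬q | yes r = trans (cong suc ih) (sym (ℕ.+-suc _ _))
... | no ¬p | yes q | yes r = contradiction r (disj x q)
... | no ¬p | yes q | no ¬r = contradiction (Equivalence.from (P⇔Q∪R x) (inj₁ q)) ¬p
... | no ¬p | no ¬q | yes r = contradiction (Equivalence.from (P⇔Q∪R x) (inj₂ r)) ¬p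
... | no ¬p | no ¬q | no ¬r = ih
... | yes p | no ¬q | no ¬r with Equivalence.to (P⇔Q∪R x) p
...   | inj₁ q = contradiction q ¬q
...   | inj₂ r = contradiction r ¬r

#-mono : {P Q : Pred A 0ℓ} (P? : Decidable P) (Q? : Decidable Q) →
  (∀ x → P x → Q x) → (xs : List A) → # P? xs ≤ # Q? xs
#-mono P? Q? P⊆Q [] = z≤n
#-mono P? Q? P⊆Q (x ∷ xs) with ih ← #-mono P? Q? P⊆Q xs | P? x | Q? x
... | yes p | yes q = s≤s ih
... | yes p | no ¬q = contradiction (P⊆Q x p) ¬q
... | no ¬p | yes q = ℕ.m≤n⇒m≤1+n ih
... | no ¬p | no ¬q = ih

#-cong : {P Q : Pred A 0ℓ} (P? : Decidable P) (Q? : Decidable Q) →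
  (∀ x → P x → Q x) → (∀ x → Q x → P x) → (xs : List A) → # P? xs ≡ # Q? xs
#-cong P? Q? P⊆Q Q⊆P xs = ℕ.≤-antisym (#-mono P? Q? P⊆Q xs) (#-mono Q? P? Q⊆P xs)

#-complement : {P : Pred A 0ℓ} (P? : Decidable P) (xs : List A) → # P? xs + # (¬? ∘ P?) xs ≡ length xs
#-complement P? [] = refl
#-complement P? (x ∷ xs) with ih ← #-complement P? xs | P? x
... | yes _ = cong suc ih
... | no _  = trans (ℕ.+-suc _ _) (cong suc ih)

module _ (_≟_ : DecidableEquality B) where
  open import Data.List.Membership.DecPropositional _≟_ using () renaming (_∈?_ to _∈ᴮ?_)

  -- Uniqueness of `ys` makes the fibres disjoint, so no `x` is counted twice.
  Σ#-fibres : (g : A → B) (xs : List A) {ys : List B} → UniqueList.Unique ys →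
    sum (List.map (λ y → # (λ x → g x ≟ y) xs) ys) ≡ # (λ x → g x ∈ᴮ? ys) xs
  Σ#-fibres g xs {[]} _ = sym (cong length (filter-none (λ x → g x ∈ᴮ? []) {xs = xs} (All.tabulate λ _ ())))
  Σ#-fibres g xs {y ∷ ys} (y∉ys ∷ ys!) = trans
    (cong (# (λ x → g x ≟ y) xs +_) (Σ#-fibres g xs ys!))
    (sym (#-⊎ (λ x → g x ∈ᴮ? (y ∷ ys)) (λ x → g x ≟ y) (λ x → g x ∈ᴮ? ys)
      (λ x → mk⇔ (λ { (here p) → inj₁ p ; (there p) → inj₂ p }) λ { (inj₁ p) → here p ; (inj₂ p) → there p })
      (λ { x refl gx∈ → All.lookup y∉ys gx∈ refl }) xs))

sum-const : (f : A → ℕ) (c : ℕ) (xs : List A) → (∀ {x} → x ∈ xs → f x ≡ c) →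
  sum (List.map f xs) ≡ length xs * c
sum-const f c []       _  = refl
sum-const f c (x ∷ xs) eq = cong₂ _+_ (eq (here refl)) (sum-const f c xs (eq ∘ there))

-- The union bound. The factor `M` on the left stands for a division: it is used with `suc q ^ m`,
-- the denominator of (q/(q+1))^m.
#-union-bound : {I : Set} {P : I → Pred A 0ℓ} {Q : Pred A 0ℓ} (P? : ∀ i → Decidable (P i)) (is : List I) →
  {xs : List A} (M c : ℕ) → (∀ {i} → i ∈ is → # (P? i) xs * M ≤ c) →
  (Q? : Decidable Q) → (∀ x → Q x → ∃[ i ] (i ∈ is × P i x)) →
  # Q? xs * M ≤ length is * c
#-union-bound P? [] {xs} M c bound Q? covers = ℕ.≤-reflexive
  (cong (λ zs → length zs * M) (filter-none Q? {xs = xs} (All.tabulate λ {x} _ q → ∉[] (proj₁ (proj₂ (covers x q))))))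
#-union-bound {P = P} {Q = Q} P? (i ∷ is) {xs} M c bound Q? covers = begin
  # Q? xs * M                          ≤⟨ ℕ.*-monoˡ-≤ M (#-union Q? (P? i) Q×¬Pᵢ? split xs) ⟩
  (# (P? i) xs + # Q×¬Pᵢ? xs) * M      ≡⟨ ℕ.*-distribʳ-+ M (# (P? i) xs) _ ⟩
  # (P? i) xs * M + # Q×¬Pᵢ? xs * M    ≤⟨ ℕ.+-mono-≤ (bound (here refl))
                                            (#-union-bound P? is {xs} M c (bound ∘ there) Q×¬Pᵢ? covers′) ⟩
  c + length is * c                    ∎
  where
  open ≤-Reasoning
  -- The tail of the index list need only cover what `P i` misses.
  Q×¬Pᵢ? : Decidable (λ x → Q x × ¬ P i x)
  Q×¬Pᵢ? x = Q? x ×-dec ¬? (P? i x)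
  split : ∀ x → Q x → P i x ⊎ (Q x × ¬ P i x)
  split x q with P? i x
  ... | yes p = inj₁ p
  ... | no ¬p = inj₂ (q , ¬p)
  covers′ : ∀ x → Q x × ¬ P i x → ∃[ j ] (j ∈ is × P j x)
  covers′ x (q , ¬p) with covers x q
  ... | j , here refl , pⱼ = contradiction pⱼ ¬p
  ... | j , there j∈  , pⱼ = j , j∈ , pⱼ

-- Exponential decay beats polynomial growth

^-distribʳ-* : ∀ d m n → (m * n) ^ d ≡ m ^ d * n ^ d
^-distribʳ-* zero    m n = refl
^-distribʳ-* (suc d) m n = trans (cong (m * n *_) (^-distribʳ-* d m n))
  (solve 4 (λ m n X Y → m :* n :* (X :* Y) := m :* X :* (n :* Y)) refl m n (m ^ d) (n ^ d))
  where open +-*-Solver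

-- Bernoulli's inequality 1 + s/q ≤ (1 + 1/q)^s, multiplied by q^(s+1).
bernoulli : ∀ q s → (q + s) * q ^ s ≤ q * suc q ^ s
bernoulli q zero    = ℕ.≤-reflexive (cong (_* 1) (ℕ.+-identityʳ q))
bernoulli q (suc s) = begin
  (q + suc s) * (q * q ^ s)                     ≡⟨ solve 3 (λ q s X → (q :+ (con 1 :+ s)) :* (q :* X) := q :* ((q :+ s) :* X) :+ q :* X) refl q s (q ^ s) ⟩
  q * ((q + s) * q ^ s) + q * q ^ s             ≤⟨ ℕ.+-mono-≤ (ℕ.*-monoʳ-≤ q (bernoulli q s))
                                                    (ℕ.≤-trans (ℕ.*-monoˡ-≤ (q ^ s) (ℕ.m≤m+n q s)) (bernoulli q s)) ⟩
  q * (q * suc q ^ s) + q * suc q ^ s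
    ≡⟨ solve 2 (λ q Y → q :* (q :* Y) :+ q :* Y := q :* ((con 1 :+ q) :* Y)) refl q (suc q ^ s) ⟩
  q * (suc q * suc q ^ s)                       ∎
  where
  open ≤-Reasoning
  open +-*-Solver

-- F n / T n tends to 0, with 1/Q in the role of ε.
Negligible : (ℕ → ℕ) → (ℕ → ℕ) → Set
Negligible F T = ∀ Q → ∃[ N ] (∀ n → N ≤ n → Q * F n < T n)

-- With m = s(d+1), Bernoulli's inequality to the power d+1 bounds (q/(q+1))^m by (q/(q+s))^(d+1).
-- For s proportional to n this wins one power of s more than n^d costs, leaving F n / T n ≤
-- C/(s+1).
negligible : (F T : ℕ → ℕ) (d E q : ℕ) .{{_ : NonZero d}} .{{_ : NonZero q}} →
  (∀ n → 0 < T n) →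
  (∀ n m → d + m * d ≤ n → F n * suc q ^ m ≤ E * n ^ d * (q ^ m * T n)) →
  Negligible F T
negligible F T d E q T>0 bound Q = N , small
  where
  c C N : ℕ
  -- Room for `y` and `suc d` blocks. For s = n / c ≥ 1 this gives d + s(d+1)d ≤ s * c ≤ n, so m =
  -- s(d+1) blocks fit.
  c = d + suc d * d
  C = q ^ suc d * (E * c ^ d)
  instance
    c≢0 : NonZero c
    c≢0 = ℕ.>-nonZero (ℕ.<-≤-trans (ℕ.>-nonZero⁻¹ d) (ℕ.m≤m+n d _))
  -- Forces n / c ≥ (C+1)(Q+1), which absorbs `C` and `Q` in C/(s+1); `suc Q` also ensures c ≤ N
  -- when Q = 0.
  N = suc C * suc Q * c

  open ≤-Reasoning
  open +-*-Solver

  linear : ∀ n → c ≤ n → suc (n ℕ./ c) * F n ≤ C * T n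
  linear n c≤n = ℕ.*-cancelʳ-≤ _ _ (suc s ^ d * q ^ m) (begin
    suc s * F n * (suc s ^ d * q ^ m)
      ≡⟨ solve 4 (λ s F X Y → s :* F :* (X :* Y) := F :* ((s :* X) :* Y)) refl (suc s) (F n) (suc s ^ d) (q ^ m) ⟩
    F n * (suc s ^ suc d * q ^ m)
      -- Trades 1 + s for q + s, the base occurring in `bernoulli`, by q ≥ 1.
      ≤⟨ ℕ.*-monoʳ-≤ (F n) (ℕ.*-monoˡ-≤ (q ^ m) (ℕ.^-monoˡ-≤ (suc d) (ℕ.+-monoˡ-≤ s (ℕ.>-nonZero⁻¹ q)))) ⟩
    F n * ((q + s) ^ suc d * q ^ m)
      ≤⟨ ℕ.*-monoʳ-≤ (F n) powers ⟩
    F n * (q ^ suc d * suc q ^ m)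
      ≡⟨ solve 3 (λ F X Y → F :* (X :* Y) := X :* (F :* Y)) refl (F n) (q ^ suc d) (suc q ^ m) ⟩
    q ^ suc d * (F n * suc q ^ m)
      ≤⟨ ℕ.*-monoʳ-≤ (q ^ suc d) (bound n m dm≤n) ⟩
    q ^ suc d * (E * n ^ d * (q ^ m * T n))
      ≤⟨ ℕ.*-monoʳ-≤ (q ^ suc d) (ℕ.*-monoˡ-≤ _ (ℕ.*-monoʳ-≤ E n^d≤)) ⟩
    q ^ suc d * (E * (c ^ d * suc s ^ d) * (q ^ m * T n))
      ≡⟨ solve 6 (λ X E Y Z W T → X :* (E :* (Y :* Z) :* (W :* T)) := X :* (E :* Y) :* T :* (Z :* W)) refl
           (q ^ suc d) E (c ^ d) (suc s ^ d) (q ^ m) (T n) ⟩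
    C * T n * (suc s ^ d * q ^ m) ∎)
    where
    s m : ℕ
    s = n ℕ./ c
    m = s * suc d
    instance
      ≢0 : NonZero (suc s ^ d * q ^ m)
      ≢0 = ℕ.m*n≢0 (suc s ^ d) (q ^ m) {{ℕ.m^n≢0 (suc s) d}} {{ℕ.m^n≢0 q m}}
    1≤s : 1 ≤ s
    1≤s = ℕ.m≥n⇒m/n>0 c≤n
    dm≤n : d + m * d ≤ n
    dm≤n = begin
      d + s * suc d * d         ≤⟨ ℕ.+-monoˡ-≤ _ (ℕ.≤-trans (ℕ.≤-reflexive (sym (ℕ.*-identityˡ d))) (ℕ.*-monoˡ-≤ d 1≤s)) ⟩
      s * d + s * suc d * d     ≡⟨ solve 3 (λ s d e → s :* d :+ s :* e :* d := s :* (d :+ e :* d)) refl s d (suc d) ⟩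
      s * c                     ≤⟨ ℕ.m/n*n≤m n c ⟩
      n                         ∎
    n≤ : n ≤ c + s * c
    n≤ = begin
      n                ≡⟨ ℕ.m≡m%n+[m/n]*n n c ⟩
      n ℕ.% c + s * c  ≤⟨ ℕ.+-monoˡ-≤ (s * c) (ℕ.<⇒≤ (ℕ.m%n<n n c)) ⟩
      c + s * c        ∎
    n^d≤ : n ^ d ≤ c ^ d * suc s ^ d
    n^d≤ = begin
      n ^ d               ≤⟨ ℕ.^-monoˡ-≤ d (n≤) ⟩
      (c + s * c) ^ d     ≡⟨ cong (_^ d) (ℕ.*-comm (suc s) c) ⟩
      (c * suc s) ^ d     ≡⟨ ^-distribʳ-* d c (suc s) ⟩
      c ^ d * suc s ^ d   ∎
    powers : (q + s) ^ suc d * q ^ m ≤ q ^ suc d * suc q ^ m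
    powers = begin
      (q + s) ^ suc d * q ^ m               ≡⟨ cong ((q + s) ^ suc d *_) (ℕ.^-*-assoc q s (suc d)) ⟨
      (q + s) ^ suc d * (q ^ s) ^ suc d     ≡⟨ ^-distribʳ-* (suc d) (q + s) (q ^ s) ⟨
      ((q + s) * q ^ s) ^ suc d             ≤⟨ ℕ.^-monoˡ-≤ (suc d) (bernoulli q s) ⟩
      (q * suc q ^ s) ^ suc d               ≡⟨ ^-distribʳ-* (suc d) q (suc q ^ s) ⟩
      q ^ suc d * (suc q ^ s) ^ suc d       ≡⟨ cong (q ^ suc d *_) (ℕ.^-*-assoc (suc q) s (suc d)) ⟩
      q ^ suc d * suc q ^ m                 ∎

  small : ∀ n → N ≤ n → Q * F n < T n
  small n N≤n = ℕ.*-cancelˡ-< (suc C) (Q * F n) (T n) (begin-strict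
    suc C * (Q * F n)       ≡⟨ solve 3 (λ C Q F → C :* (Q :* F) := C :* Q :* F) refl (suc C) Q (F n) ⟩
    suc C * Q * F n         ≤⟨ ℕ.*-monoˡ-≤ (F n) (begin
      suc C * Q                 ≤⟨ ℕ.*-monoʳ-≤ (suc C) (ℕ.n≤1+n Q) ⟩
      suc C * suc Q             ≡⟨ ℕ.m*n/n≡m (suc C * suc Q) c ⟨
      N ℕ./ c                   ≤⟨ ℕ./-monoˡ-≤ c N≤n ⟩
      n ℕ./ c                   ≤⟨ ℕ.n≤1+n _ ⟩
      suc (n ℕ./ c)             ∎) ⟩
    suc (n ℕ./ c) * F n     ≤⟨ linear n (ℕ.≤-trans (ℕ.m≤m+n c _) N≤n) ⟩
    C * T n                 <⟨ ℕ.*-monoˡ-< (T n) {{ℕ.>-nonZero (T>0 n)}} (ℕ.n<1+n C) ⟩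
    suc C * T n             ∎)

-- The bound is asked for positive `n` only, because an empty universe offers no default element
-- later on; hence the `suc` in the threshold.
negligible-+ : ∀ {F G H T} → Negligible F T → Negligible G T → (∀ n → 0 < n → H n ≤ F n + G n) → Negligible H T
negligible-+ {F} {G} {H} {T} F≪ G≪ H≤ Q with F≪ (2 * Q) | G≪ (2 * Q)
... | M , small-F | N , small-G = suc (M + N) , λ n M+N<n → let M+N≤n = ℕ.<⇒≤ M+N<n in ℕ.*-cancelˡ-< 2 _ _ (begin-strict
  2 * (Q * H n)               ≤⟨ ℕ.*-monoʳ-≤ 2 (ℕ.*-monoʳ-≤ Q (H≤ n (ℕ.≤-<-trans z≤n M+N<n))) ⟩
  2 * (Q * (F n + G n))
    ≡⟨ solve 3 (λ Q F G → con 2 :* (Q :* (F :+ G)) := con 2 :* Q :* F :+ con 2 :* Q :* G) refl Q (F n) (G n) ⟩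
  2 * Q * F n + 2 * Q * G n   <⟨ ℕ.+-mono-< (small-F n (ℕ.m+n≤o⇒m≤o M M+N≤n)) (small-G n (ℕ.m+n≤o⇒n≤o M M+N≤n)) ⟩
  T n + T n                   ≡⟨ cong (T n +_) (ℕ.+-identityʳ (T n)) ⟨
  2 * T n                     ∎)
  where
  open ≤-Reasoning
  open +-*-Solver

-- Structures as families of truth tables

lookup-ext : ∀ {A : Set} {n} {xs ys : Vec A n} → (∀ i → lookup xs i ≡ lookup ys i) → xs ≡ ys
lookup-ext {xs = xs} {ys} eq =
  trans (sym (tabulate∘lookup xs)) (trans (tabulate-cong eq) (tabulate∘lookup ys))

T-ext : ∀ {b c} → (T b → T c) → (T c → T b) → b ≡ c
T-ext {false} {false} _ _ = refl
T-ext {false} {true}  _ g = ⊥-elim (g tt)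
T-ext {true}  {false} f _ = ⊥-elim (f tt)
T-ext {true}  {true}  _ _ = refl

lookupᴿ∘tabulateᴿ : ∀ {n m} (f : Vec (Fin n) m → Bool) a → lookupᴿ (tabulateᴿ f) a ≡ f a
lookupᴿ∘tabulateᴿ f []      = refl
lookupᴿ∘tabulateᴿ f (x ∷ a) =
  trans (cong (λ r → lookupᴿ r a) (lookup∘tabulate (λ x → tabulateᴿ λ a → f (x ∷ a)) x))
        (lookupᴿ∘tabulateᴿ (λ a → f (x ∷ a)) a)

relation-ext : ∀ {n m} {r s : Relation n m} → (∀ a → lookupᴿ r a ≡ lookupᴿ s a) → r ≡ s
relation-ext {m = zero}  eq = eq []
relation-ext {m = suc m} eq = lookup-ext λ x → relation-ext λ a → eq (x ∷ a)

bit : ∀ {V n} → Structure V n → ∀ {m} → m ∈ V → Vec (Fin n) m → Bool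
bit M R a = lookupᴿ (All.lookup M R) a

structure-ext : ∀ {V n} {M N : Structure V n} →
  (∀ {m} (R : m ∈ V) a → bit M R a ≡ bit N R a) → M ≡ N
structure-ext {M = []}    {[]}    eq = refl
structure-ext {M = _ ∷ _} {_ ∷ _} eq =
  cong₂ _∷_ (relation-ext (eq (here refl))) (structure-ext λ R → eq (there R))

opaque
  -- Opaque, so that a structure given by a rule is accessed through `bit-tabulateˢ` alone.
  tabulateˢ : ∀ {V n} → (∀ {m} → m ∈ V → Vec (Fin n) m → Bool) → Structure V n
  tabulateˢ f = All.tabulate λ R → tabulateᴿ (f R)

  bit-tabulateˢ : ∀ {V n} (f : ∀ {m} → m ∈ V → Vec (Fin n) m → Bool) {m} (R : m ∈ V) a →
    bit (tabulateˢ f) R a ≡ f R a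
  bit-tabulateˢ f (here refl) a = lookupᴿ∘tabulateᴿ (f (here refl)) a
  bit-tabulateˢ f (there R)   a = bit-tabulateˢ (λ R → f (there R)) R a

∈-vecs : ∀ {A : Set} {as : List A} → (∀ a → a ∈ as) → ∀ {m} (v : Vec A m) → v ∈ vecs as m
∈-vecs complete []      = here refl
∈-vecs complete (a ∷ v) = ∈-cartesianProductWith⁺ _∷_ (complete a) (∈-vecs complete v)

vecs-! : ∀ {A : Set} {as : List A} → UniqueList.Unique as → ∀ m → UniqueList.Unique (vecs as m)
vecs-! as! zero    = [] ∷ []
vecs-! as! (suc m) = UniqueList.cartesianProductWith⁺ _∷_ ∷-injective as! (vecs-! as! m)

length-cartesianProductWith : ∀ {A B C : Set} (f : A → B → C) xs ys →
  length (List.cartesianProductWith f xs ys) ≡ length xs * length ys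
length-cartesianProductWith f []       ys = refl
length-cartesianProductWith f (x ∷ xs) ys = trans (length-++ (List.map (f x) ys))
  (cong₂ _+_ (length-map (f x) ys) (length-cartesianProductWith f xs ys))

length-vecs : ∀ {A : Set} (as : List A) m → length (vecs as m) ≡ length as ^ m
length-vecs as zero    = refl
length-vecs as (suc m) = trans (length-cartesianProductWith _∷_ as (vecs as m))
  (cong (length as *_) (length-vecs as m))

∈-relations : ∀ {n m} (r : Relation n m) → r ∈ relations n m
∈-relations {m = zero}  true  = here refl
∈-relations {m = zero}  false = there (here refl)
∈-relations {m = suc m} r     = ∈-vecs ∈-relations r

relations-! : ∀ n m → UniqueList.Unique (relations n m)
relations-! n zero    = ((λ ()) ∷ []) ∷ [] ∷ []
relations-! n (suc m) = vecs-! (relations-! n m) n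

∈-structures : ∀ {V n} (M : Structure V n) → M ∈ structures V n
∈-structures []      = here refl
∈-structures (r ∷ M) = ∈-cartesianProductWith⁺ _∷_ (∈-relations r) (∈-structures M)

structures-! : ∀ V n → UniqueList.Unique (structures V n)
structures-! []      n = [] ∷ []
structures-! (m ∷ V) n =
  UniqueList.cartesianProductWith⁺ _∷_ (λ { refl → refl , refl }) (relations-! n m) (structures-! V n)

-- Truncation to tuples with few distinct elements

bit-↾ : ∀ {V n} (M : Structure V n) d {m} (R : m ∈ V) a →
  bit (M ↾ d) R a ≡ bit M R a ∧ does (distinct a ≤? d)
bit-↾ M d R a = trans (cong (λ r → lookupᴿ r a) (All.lookup-map M R)) (lookupᴿ∘tabulateᴿ _ a)

bit-↾-≤ : ∀ {V n} (M : Structure V n) {d m} (R : m ∈ V) a → distinct a ≤ d → bit (M ↾ d) R a ≡ bit M R a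
bit-↾-≤ M {d} R a ≤d = trans (bit-↾ M d R a)
  (trans (cong (bit M R a ∧_) (dec-true (distinct a ≤? d) ≤d)) (∧-identityʳ _))

bit-↾-≰ : ∀ {V n} (M : Structure V n) {d m} (R : m ∈ V) a → ¬ (distinct a ≤ d) → bit (M ↾ d) R a ≡ false
bit-↾-≰ M {d} R a ≰d = trans (bit-↾ M d R a)
  (trans (cong (bit M R a ∧_) (dec-false (distinct a ≤? d) ≰d)) (∧-zeroʳ _))

↾-ext : ∀ {V n} {M N : Structure V n} {d} →
  (∀ {m} (R : m ∈ V) a → distinct a ≤ d → bit M R a ≡ bit N R a) → M ↾ d ≡ N ↾ d
↾-ext {M = M} {N} {d} eq = structure-ext agree
  where
  agree : ∀ {m} (R : m ∈ _) a → bit (M ↾ d) R a ≡ bit (N ↾ d) R a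
  agree R a with distinct a ≤? d
  ... | yes ≤d = trans (bit-↾-≤ M R a ≤d) (trans (eq R a ≤d) (sym (bit-↾-≤ N R a ≤d)))
  ... | no ≰d  = trans (bit-↾-≰ M R a ≰d) (sym (bit-↾-≰ N R a ≰d))

↾-ext⁻ : ∀ {V n} {M N : Structure V n} {d} → M ↾ d ≡ N ↾ d →
  ∀ {m} (R : m ∈ V) a → distinct a ≤ d → bit M R a ≡ bit N R a
↾-ext⁻ {M = M} {N} eq R a ≤d =
  trans (sym (bit-↾-≤ M R a ≤d)) (trans (cong (λ L → bit L R a) eq) (bit-↾-≤ N R a ≤d))

↾-↾ : ∀ {V n} (M : Structure V n) {d e} → e ≤ d → (M ↾ d) ↾ e ≡ M ↾ e
↾-↾ M {d} e≤d = ↾-ext λ R a ≤e → bit-↾-≤ M R a (ℕ.≤-trans ≤e e≤d)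

distinct≤ : ∀ {n m} (a : Vec (Fin n) m) → distinct a ≤ m
distinct≤ a = ℕ.≤-trans (length-deduplicate _≟ᶠ_ (toList a)) (ℕ.≤-reflexive (length-toList a))
  where
  length-toList : ∀ {n m} (a : Vec (Fin n) m) → length (toList a) ≡ m
  length-toList []      = refl
  length-toList (_ ∷ a) = cong suc (length-toList a)

0<distinct : ∀ {n m} (a : Vec (Fin n) m) → 1 ≤ m → 0 < distinct a
0<distinct (x ∷ a) _ = s≤s z≤n

length≤1⇒≡ : ∀ {A : Set} {xs : List A} {x y} → length xs ≤ 1 → x ∈ xs → y ∈ xs → x ≡ y
length≤1⇒≡ {xs = x ∷ []} _ (here refl) (here refl) = refl
length≤1⇒≡ {xs = x ∷ _ ∷ _} (s≤s ())

-- Needed for level 1: such a tuple is monochromatic in every colouring, whatever the colours turn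
-- out to be.
distinct≤1⇒≡ : ∀ {n m} (a : Vec (Fin n) m) → distinct a ≤ 1 → ∀ p q → lookup a p ≡ lookup a q
distinct≤1⇒≡ a ≤1 p q = length≤1⇒≡ ≤1 (∈-distinct p) (∈-distinct q)
  where
  ∈-distinct : ∀ p → lookup a p ∈ deduplicate _≟ᶠ_ (toList a)
  ∈-distinct p = ∈-deduplicate⁺ _≟ᶠ_ (Vec.∈-toList⁺ (Vec.∈-lookup p a))

-- The symbols of `L l V`: relations of `V` and colour predicates

position : ∀ {l} → Fin l → 1 ∈ replicate l 1
position zero    = here refl
position (suc i) = there (position i)

-- The local function of P cannot be named from outside: the metavariable below is
-- solved with it, once its parameters have been generalised by the with-abstraction.
mutual
  localPosition : ∀ (k : ℕ) (V : Vocabulary) (j : Fin k) (l : ℕ) → Fin l → 1 ∈ replicate l 1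
  localPosition = _

  P-suc : ∀ l V (i : Fin l) → P {suc l} {V} (suc i) ≡
    ∈-++⁺ʳ V {ys = 1 ∷ replicate l 1} (there (localPosition (suc l) V (suc i) l i))
  P-suc l V i with suc l | suc i
  ... | _ | _ = refl

localPosition≡position : ∀ k V j l (i : Fin l) → localPosition k V j l i ≡ position i
localPosition≡position k V j (suc l) zero    = refl
localPosition≡position k V j (suc l) (suc i) = cong there (localPosition≡position k V j l i)

P≡position : ∀ {l} V (i : Fin l) → P {l} {V} i ≡ ∈-++⁺ʳ V (position i)
P≡position         V zero    = refl
P≡position {suc l} V (suc i) =
  cong (λ p → ∈-++⁺ʳ V (there p)) (localPosition≡position (suc l) V (suc i) l i)

-- The index of `colour` is `P` itself and not `position`, so that matching on this view meets
-- `HasColour` directly.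
data LSymbol {l : ℕ} {V : Vocabulary} : ∀ {m} → m ∈ L l V → Set where
  relation : ∀ {m} (R : m ∈ V) → LSymbol (∈-++⁺ˡ R)
  colour   : (i : Fin l) → LSymbol (P {l} {V} i)

data Position {l : ℕ} : ∀ {m} → m ∈ replicate l 1 → Set where
  at : (i : Fin l) → Position (position i)

positionOf : ∀ {l m} (R : m ∈ replicate l 1) → Position {l} R
positionOf {suc l} (here refl) = at zero
positionOf {suc l} (there R) with positionOf {l} R
... | at i = at (suc i)

lSymbol : ∀ l V {m} (R : m ∈ L l V) → LSymbol {l} {V} R
lSymbol l [] R with positionOf {l} R
... | at i = subst (LSymbol {l} {[]}) (P≡position [] i) (colour i)
lSymbol l (m ∷ V) (here refl) = relation (here refl)
lSymbol l (m ∷ V) (there R) with lSymbol l V R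
... | relation R = relation (there R)
... | colour i   = subst (LSymbol {l} {m ∷ V})
  (trans (P≡position (m ∷ V) i) (cong there (sym (P≡position V i)))) (colour i)

colourTables : ∀ {l n} → (Fin l → Relation n 1) → All (Relation n) (replicate l 1)
colourTables {zero}  f = []
colourTables {suc l} f = f zero ∷ colourTables (f ∘ suc)

lookup-colourTables : ∀ {l n} (f : Fin l → Relation n 1) i → All.lookup (colourTables f) (position i) ≡ f i
lookup-colourTables f zero    = refl
lookup-colourTables f (suc i) = lookup-colourTables (f ∘ suc) i

lookup-++⁺ˡ : ∀ {V W n m} (M : Structure V n) (N : Structure W n) (R : m ∈ V) →
  All.lookup (All.++⁺ M N) (∈-++⁺ˡ R) ≡ All.lookup M R
lookup-++⁺ˡ (_ ∷ M) N (here refl) = refl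
lookup-++⁺ˡ (_ ∷ M) N (there R)   = lookup-++⁺ˡ M N R

lookup-++⁺ʳ : ∀ {V W n m} (M : Structure V n) (N : Structure W n) (R : m ∈ W) →
  All.lookup (All.++⁺ M N) (∈-++⁺ʳ V R) ≡ All.lookup N R
lookup-++⁺ʳ []      N R = refl
lookup-++⁺ʳ (_ ∷ M) N R = lookup-++⁺ʳ M N R

opaque
  coloured : ∀ {l V n} → Vec (Fin l) n → Structure V n → Structure (L l V) n
  coloured γ M = All.++⁺ M (colourTables λ i → tabulateᴿ λ a → does (lookup γ (lookup a zero) ≟ᶠ i))

module _ {l V n} (γ : Vec (Fin l) n) (M : Structure V n) where

  opaque
    unfolding coloured

    bit-coloured : ∀ {m} (R : m ∈ V) a → bit (coloured γ M) (∈-++⁺ˡ R) a ≡ bit M R a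
    bit-coloured R a = cong (λ r → lookupᴿ r a) (lookup-++⁺ˡ M _ R)

    colour-coloured : ∀ i x → bit (coloured γ M) (P {l} {V} i) (x ∷ []) ≡ does (lookup γ x ≟ᶠ i)
    colour-coloured i x = trans (cong (λ R → bit (coloured γ M) R (x ∷ [])) (P≡position V i))
      (trans (cong (λ r → lookupᴿ r (x ∷ [])) (trans (lookup-++⁺ʳ M _ (position i)) (lookup-colourTables _ i)))
             (lookupᴿ∘tabulateᴿ (λ a → does (lookup γ (lookup a zero) ≟ᶠ i)) (x ∷ [])))


  hasColour⁺ : ∀ x → HasColour {l} {V} (coloured γ M) x (lookup γ x)
  hasColour⁺ x = subst T (sym (trans (colour-coloured (lookup γ x) x) (dec-true (lookup γ x ≟ᶠ lookup γ x) refl))) tt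

  hasColour⁻ : ∀ {x i} → HasColour {l} {V} (coloured γ M) x i → lookup γ x ≡ i
  hasColour⁻ {x} {i} h with lookup γ x ≟ᶠ i | colour-coloured i x
  ... | yes eq | _   = eq
  ... | no _   | eq′ = ⊥-elim (subst T eq′ h)

bit-reduct : ∀ {l} V {n} (M : Structure (L l V) n) {m} (R : m ∈ V) a →
  bit (reduct l V M) R a ≡ bit M (∈-++⁺ˡ R) a
bit-reduct (_ ∷ V) (r ∷ M) (here refl) a = refl
bit-reduct (_ ∷ V) (r ∷ M) (there R)   a = bit-reduct V M R a

reduct-coloured : ∀ {l V n} (γ : Vec (Fin l) n) (M : Structure V n) → reduct l V (coloured γ M) ≡ M
reduct-coloured {V = V} γ M = structure-ext λ R a → trans (bit-reduct V (coloured γ M) R a) (bit-coloured γ M R a)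

-- Outcomes and the `𝐊`-structures they produce

Mono : ∀ {c n m} → Vec (Fin c) n → Vec (Fin n) m → Set
Mono γ a = ∀ p q → lookup γ (lookup a p) ≡ lookup γ (lookup a q)

mono? : ∀ {c n m} (γ : Vec (Fin c) n) (a : Vec (Fin n) m) → Dec (Mono γ a)
mono? γ a = all? λ p → all? λ q → lookup γ (lookup a p) ≟ᶠ lookup γ (lookup a q)

¬mono⇒∃ : ∀ {c n m} (γ : Vec (Fin c) n) (a : Vec (Fin n) m) → ¬ Mono γ a →
  ∃[ p ] ∃[ q ] lookup γ (lookup a p) ≢ lookup γ (lookup a q)
¬mono⇒∃ γ a ¬mono
  with p , ¬p ← ¬∀⟶∃¬ _ _ (λ p → all? λ q → lookup γ (lookup a p) ≟ᶠ lookup γ (lookup a q)) ¬mono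
  = p , ¬∀⟶∃¬ _ _ (λ q → lookup γ (lookup a p) ≟ᶠ lookup γ (lookup a q)) ¬p

Ω : ℕ → Vocabulary → ℕ → Set
Ω l V n = Vec (Fin l) n × Structure V n

outcomes : ∀ l V n → List (Ω l V n)
outcomes l V n = cartesianProduct (vecs (List.allFin l) n) (structures V n)

outcomes-! : ∀ l V n → UniqueList.Unique (outcomes l V n)
outcomes-! l V n = UniqueList.cartesianProduct⁺ (vecs-! (UniqueList.allFin⁺ l) n) (structures-! V n)

∈-outcomes : ∀ {l V n} (ω : Ω l V n) → ω ∈ outcomes l V n
∈-outcomes (γ , N) = ∈-cartesianProduct⁺ (∈-vecs ∈-allFin γ) (∈-structures N)

opaque
  proper : ∀ {l V n} → Ω l V n → Structure V n
  proper (γ , N) = tabulateˢ λ R a → bit N R a ∧ not (does (mono? γ a))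

module _ {l V n} (γ : Vec (Fin l) n) (N : Structure V n) where

  opaque
    unfolding proper

    bit-mono : ∀ {m} (R : m ∈ V) a → Mono γ a → bit (proper (γ , N)) R a ≡ false
    bit-mono R a mono = trans (bit-tabulateˢ _ R a)
      (trans (cong (λ b → bit N R a ∧ not b) (dec-true (mono? γ a) mono)) (∧-zeroʳ _))

    bit-¬mono : ∀ {m} (R : m ∈ V) a → ¬ Mono γ a → bit (proper (γ , N)) R a ≡ bit N R a
    bit-¬mono R a ¬mono = trans (bit-tabulateˢ _ R a)
      (trans (cong (λ b → bit N R a ∧ not b) (dec-false (mono? γ a) ¬mono)) (∧-identityʳ _))


  proper-colouring : IsColouring (proper (γ , N)) γ
  proper-colouring R a holds mono = ⊥-elim (subst T (bit-mono R a mono) holds)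

  proper-fixed : IsColouring N γ → proper (γ , N) ≡ N
  proper-fixed isCol = structure-ext eq
    where
    eq : ∀ {m} (R : m ∈ V) a → bit (proper (γ , N)) R a ≡ bit N R a
    eq R a with mono? γ a
    ... | no ¬mono = bit-¬mono R a ¬mono
    ... | yes mono = trans (bit-mono R a mono) (T-ext ⊥-elim λ h → isCol R a h mono)

mask : ∀ {l V n} → Ω l V n → Structure (L l V) n
mask ω = coloured (proj₁ ω) (proper ω)

mask∈𝐊 : ∀ {l V n} (ω : Ω l V n) → In𝐊 l V n (mask ω)
mask∈𝐊 {l} {V} {n} ω@(γ , N) = (λ x → lookup γ x , hasColour⁺ γ M x , hasColour⁻ γ M) , two-colours
  where
  M = proper ω
  two-colours : ∀ {m} (R : m ∈ V) (a : Vec (Fin n) m) → Holds (reduct l V (mask ω)) R a →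
    ∃[ p ] ∃[ q ] ∃[ i ] ∃[ j ] (HasColour {l} {V} (mask ω) (lookup a p) i ×
      HasColour {l} {V} (mask ω) (lookup a q) j × i ≢ j)
  two-colours R a holds
    with p , q , ≢ ← ¬mono⇒∃ γ a (proper-colouring γ N R a (subst (λ M → Holds M R a) (reduct-coloured γ M) holds))
    = p , q , _ , _ , hasColour⁺ γ M _ , hasColour⁺ γ M _ , ≢

module _ {l V n} {M N : Structure (L l V) n} where

  L-ext : (∀ {m} (R : m ∈ V) a → bit M (∈-++⁺ˡ R) a ≡ bit N (∈-++⁺ˡ R) a) →
    (∀ i x → bit M (P {l} {V} i) (x ∷ []) ≡ bit N (P {l} {V} i) (x ∷ [])) → M ≡ N
  L-ext relations colours = structure-ext agree
    where
    agree : ∀ {m} (R : m ∈ L l V) a → bit M R a ≡ bit N R a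
    agree R a with lSymbol l V R
    agree _ a        | relation R = relations R a
    agree _ (x ∷ []) | colour i   = colours i x

-- The reduct of `M` serves as `N`: it has no monochromatic tuple, so `proper` removes nothing.
𝐊⇒mask : ∀ {l V n} (M : Structure (L l V) n) → In𝐊 l V n M → ∃[ ω ] M ≡ mask ω
𝐊⇒mask {l} {V} {n} M (colours , two-colours) = (γ , N) , L-ext relations≡ colours≡
  where
  γ : Vec (Fin l) n
  γ = tabulate λ x → proj₁ (colours x)
  N = reduct l V M
  γ≡ : ∀ {x i} → HasColour {l} {V} M x i → lookup γ x ≡ i
  γ≡ {x} h = trans (lookup∘tabulate _ x) (proj₂ (proj₂ (colours x)) h)
  γ-hasColour : ∀ x → HasColour {l} {V} M x (lookup γ x)
  γ-hasColour x = subst (HasColour {l} {V} M x) (sym (lookup∘tabulate _ x)) (proj₁ (proj₂ (colours x)))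
  γ-colouring : IsColouring N γ
  γ-colouring R a holds mono with two-colours R a holds
  ... | p , q , i , j , hᵢ , hⱼ , i≢j = i≢j (trans (sym (γ≡ hᵢ)) (trans (mono p q) (γ≡ hⱼ)))
  relations≡ : ∀ {m} (R : m ∈ V) a → bit M (∈-++⁺ˡ R) a ≡ bit (mask (γ , N)) (∈-++⁺ˡ R) a
  relations≡ R a = sym (trans (bit-coloured γ (proper (γ , N)) R a)
    (trans (cong (λ N → bit N R a) (proper-fixed γ N γ-colouring)) (bit-reduct V M R a)))
  colours≡ : ∀ i x → bit M (P {l} {V} i) (x ∷ []) ≡ bit (mask (γ , N)) (P {l} {V} i) (x ∷ [])
  colours≡ i x = T-ext
    (λ h → subst (HasColour {l} {V} (mask (γ , N)) x) (γ≡ h) (hasColour⁺ γ (proper (γ , N)) x))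
    (λ h → subst (HasColour {l} {V} M x) (hasColour⁻ γ (proper (γ , N)) h) (γ-hasColour x))

-- Rational masses with natural numerators

ι : ℕ → ℚ
ι k = ℤ.+ k / 1

toℚᵘ-ι : ∀ k → ℚ.toℚᵘ (ι k) ℚᵘ.≃ ℚᵘ.mkℚᵘ (ℤ.+ k) 0
toℚᵘ-ι k = ℚ.toℚᵘ-fromℚᵘ (ℚᵘ.mkℚᵘ (ℤ.+ k) 0)

ι-+ : ∀ a b → ι (a + b) ≡ ι a ℚ.+ ι b
ι-+ a b = ℚ.toℚᵘ-injective (ℚᵘ.≃-trans (toℚᵘ-ι (a + b)) (ℚᵘ.≃-sym
  (ℚᵘ.≃-trans (ℚ.toℚᵘ-homo-+ (ι a) (ι b))
  (ℚᵘ.≃-trans (ℚᵘ.+-cong (toℚᵘ-ι a) (toℚᵘ-ι b))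
  (ℚᵘ.*≡* (cong (ℤ._* ℤ.1ℤ) (trans (cong₂ ℤ._+_ (ℤ.*-identityʳ (ℤ.+ a)) (ℤ.*-identityʳ (ℤ.+ b)))
    (sym (ℤ.pos-+ a b)))))))))

ι-* : ∀ a b → ι (a * b) ≡ ι a ℚ.* ι b
ι-* a b = ℚ.toℚᵘ-injective (ℚᵘ.≃-trans (toℚᵘ-ι (a * b)) (ℚᵘ.≃-sym
  (ℚᵘ.≃-trans (ℚ.toℚᵘ-homo-* (ι a) (ι b))
  (ℚᵘ.≃-trans (ℚᵘ.*-cong (toℚᵘ-ι a) (toℚᵘ-ι b))
  (ℚᵘ.*≡* (cong (ℤ._* ℤ.1ℤ) (sym (ℤ.pos-* a b))))))))

ι-inverse : ∀ k → ι (suc k) ℚ.* (ℤ.+ 1 / suc k) ≡ 1ℚ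
ι-inverse k = ℚ.toℚᵘ-injective
  (ℚᵘ.≃-trans (ℚ.toℚᵘ-homo-* (ι (suc k)) (ℤ.+ 1 / suc k))
  (ℚᵘ.≃-trans (ℚᵘ.*-cong (toℚᵘ-ι (suc k)) (ℚ.toℚᵘ-fromℚᵘ (ℚᵘ.mkℚᵘ (ℤ.+ 1) k)))
  (ℚᵘ.*≡* (trans (ℤ.*-identityʳ (ℤ.+ suc k ℤ.* ℤ.1ℤ))
    (trans (ℤ.*-identityʳ (ℤ.+ suc k))
      (trans (cong (λ m → ℤ.+ suc m) (sym (ℕ.+-identityʳ k))) (sym (ℤ.*-identityˡ (ℤ.+ suc (k + 0))))))))))

÷-cancelˡ : ∀ f .{{_ : NonZero f}} p → (ι f ℚ.* p) ÷ f ≡ p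
÷-cancelˡ (suc k) p = begin
  ι (suc k) ℚ.* p ℚ.* q   ≡⟨ cong (ℚ._* q) (ℚ.*-comm (ι (suc k)) p) ⟩
  p ℚ.* ι (suc k) ℚ.* q   ≡⟨ ℚ.*-assoc p _ q ⟩
  p ℚ.* (ι (suc k) ℚ.* q) ≡⟨ cong (p ℚ.*_) (ι-inverse k) ⟩
  p ℚ.* 1ℚ                ≡⟨ ℚ.*-identityʳ p ⟩
  p                       ∎
  where
  open ≡-Reasoning
  q = ℤ.+ 1 / suc k

sumℚ-ι : ∀ {A : Set} (f : A → ℚ) (g : A → ℕ) (w : ℚ) (xs : List A) →
  (∀ {x} → x ∈ xs → f x ≡ ι (g x) ℚ.* w) → sumℚ (List.map f xs) ≡ ι (sum (List.map g xs)) ℚ.* w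
sumℚ-ι f g w []       _  = sym (ℚ.*-zeroˡ w)
sumℚ-ι f g w (x ∷ xs) eq = begin
  f x ℚ.+ sumℚ (List.map f xs)
    ≡⟨ cong₂ ℚ._+_ (eq (here refl)) (sumℚ-ι f g w xs (eq ∘ there)) ⟩
  ι (g x) ℚ.* w ℚ.+ ι (sum (List.map g xs)) ℚ.* w
    ≡⟨ ℚ.*-distribʳ-+ w (ι (g x)) _ ⟨
  (ι (g x) ℚ.+ ι (sum (List.map g xs))) ℚ.* w
    ≡⟨ cong (ℚ._* w) (ι-+ (g x) _) ⟨
  ι (g x + sum (List.map g xs)) ℚ.* w ∎
  where open ≡-Reasoning

length≡1 : ∀ {A : Set} {xs : List A} {x} → UniqueList.Unique xs → x ∈ xs → (∀ {y} → y ∈ xs → y ≡ x) → length xs ≡ 1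
length≡1 {xs = _ ∷ []}    _ _ _ = refl
length≡1 {xs = _ ∷ _ ∷ _} ((≢ ∷ _) ∷ _) _ eq =
  contradiction (trans (eq (here refl)) (sym (eq (there (here refl))))) ≢

-- The measure as an image of the uniform distribution on outcomes

module Measure (l : ℕ) (V : Vocabulary) (n : ℕ) (arities : All (2 ≤_) V) (ω₀ : Ω l V n) where

  size : ℕ
  size = length (outcomes l V n)

  private
    inhabited : ∀ {A : Set} {x : A} {xs} → x ∈ xs → length xs ≡ suc (ℕ.pred (length xs))
    inhabited {xs = _ ∷ _} _ = refl

  size≡ : size ≡ suc (ℕ.pred size)
  size≡ = inhabited (∈-outcomes ω₀)

  size>0 : 0 < size
  size>0 = subst (0 <_) (sym size≡) (s≤s z≤n)

  w : ℚ
  -- The mass of a single outcome; the denominator equals `size` because `ω₀` is an outcome.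
  w = ℤ.+ 1 / suc (ℕ.pred size)

  size*w : ι size ℚ.* w ≡ 1ℚ
  size*w = trans (cong (λ t → ι t ℚ.* w) size≡) (ι-inverse (ℕ.pred size))

  ∈𝐊⁺ : ∀ (ω : Ω l V n) → mask ω ∈ 𝐊 l V n
  ∈𝐊⁺ ω = ∈-filter⁺ (in𝐊? l V n) (∈-structures (mask ω)) (mask∈𝐊 ω)

  ∈𝐊↾⁺ : ∀ r (ω : Ω l V n) → mask ω ↾ r ∈ 𝐊↾ l V n r
  ∈𝐊↾⁺ r ω = ∈-deduplicate⁺ _≟ˢ_ (∈-map⁺ (_↾ r) (∈𝐊⁺ ω))

  opaque
    ∈𝐊⁻ : ∀ {M} → M ∈ 𝐊 l V n → Σ (Ω l V n) λ ω → M ≡ mask ω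
    ∈𝐊⁻ {M} M∈ = 𝐊⇒mask M (proj₂ (∈-filter⁻ (in𝐊? l V n) {xs = structures (L l V) n} M∈))

    ∈𝐊↾⁻ : ∀ {r B} → B ∈ 𝐊↾ l V n r → Σ (Ω l V n) λ ω → B ≡ mask ω ↾ r
    ∈𝐊↾⁻ {r} {B} B∈ = fromImage (∈-map⁻ (_↾ r) (∈-deduplicate⁻ _≟ˢ_ (List.map (_↾ r) (𝐊 l V n)) B∈))
      where
      fromImage : ∃[ M ] (M ∈ 𝐊 l V n × B ≡ M ↾ r) → Σ (Ω l V n) λ ω → B ≡ mask ω ↾ r
      fromImage (M , M∈ , eq) = proj₁ (∈𝐊⁻ M∈) , trans eq (cong (_↾ r) (proj₂ (∈𝐊⁻ M∈)))

  𝐊↾-! : ∀ r → UniqueList.Unique (𝐊↾ l V n r)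
  𝐊↾-! r = UniqueDec.deduplicate-! _≟ˢ_ (List.map (_↾ r) (𝐊 l V n))

  arity>0 : ∀ {m} → m ∈ L l V → 1 ≤ m
  arity>0 R with lSymbol l V R
  ... | relation R = ℕ.<⇒≤ (All.lookup arities R)
  ... | colour _   = ℕ.≤-refl

  ↾0-≡ : ∀ (M N : Structure (L l V) n) → M ↾ 0 ≡ N ↾ 0
  ↾0-≡ M N = ↾-ext λ R a ≤0 → contradiction (ℕ.≤-trans (0<distinct a (arity>0 R)) ≤0) λ ()

  ↾ρ-≡ : ∀ (M : Structure (L l V) n) → M ↾ ρ (L l V) ≡ M
  ↾ρ-≡ M = structure-ext λ R a → bit-↾-≤ M R a (ℕ.≤-trans (distinct≤ a) (All.lookup (xs≤max 0 (L l V)) R))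

  fibre : ℕ → Structure (L l V) n → ℕ
  fibre r B = # (λ ω → (mask ω ↾ r) ≟ˢ B) (outcomes l V n)

  -- A colour predicate takes a 1-tuple, which survives every truncation from level 1 on.
  colours-↾ : ∀ {r} (ω ω′ : Ω l V n) → mask ω ↾ suc r ≡ mask ω′ ↾ suc r → proj₁ ω ≡ proj₁ ω′
  colours-↾ ω@(γ , N) ω′@(γ′ , N′) eq = lookup-ext λ x → sym (hasColour⁻ γ′ (proper ω′)
    (subst T (↾-ext⁻ {M = mask ω} {mask ω′} eq (P {l} {V} (lookup γ x)) (x ∷ []) (s≤s z≤n)) (hasColour⁺ γ (proper ω) x)))

  rels-↾ : ∀ {r} (ω ω′ : Ω l V n) → mask ω ↾ r ≡ mask ω′ ↾ r →
    ∀ {m} (R : m ∈ V) a → distinct a ≤ r → bit (proper ω) R a ≡ bit (proper ω′) R a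
  rels-↾ ω@(γ , _) ω′@(γ′ , _) eq R a ≤r = begin
    bit (proper ω) R a         ≡⟨ bit-coloured γ (proper ω) R a ⟨
    bit (mask ω) (∈-++⁺ˡ R) a  ≡⟨ ↾-ext⁻ {M = mask ω} {mask ω′} eq (∈-++⁺ˡ R) a ≤r ⟩
    bit (mask ω′) (∈-++⁺ˡ R) a ≡⟨ bit-coloured γ′ (proper ω′) R a ⟩
    bit (proper ω′) R a        ∎
    where open ≡-Reasoning

  mask-↾-ext : ∀ {r} (ω ω′ : Ω l V n) → proj₁ ω ≡ proj₁ ω′ →
    (∀ {m} (R : m ∈ V) a → distinct a ≤ r → bit (proper ω) R a ≡ bit (proper ω′) R a) →
    mask ω ↾ r ≡ mask ω′ ↾ r
  mask-↾-ext {r} ω@(γ , N) ω′@(_ , N′) refl rels = ↾-ext agree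
    where
    agree : ∀ {m} (R : m ∈ L l V) a → distinct a ≤ r → bit (mask ω) R a ≡ bit (mask ω′) R a
    agree R a ≤r with lSymbol l V R
    ... | relation R = trans (bit-coloured γ (proper ω) R a) (trans (rels R a ≤r) (sym (bit-coloured γ (proper ω′) R a)))
    agree _ (x ∷ []) ≤r | colour i = trans (colour-coloured γ (proper ω) i x) (sym (colour-coloured γ (proper ω′) i x))

  -- Copying the colours and the small properly coloured tuples of ω₂ maps one fibre
  -- injectively to another: what is overwritten is known from the fibre.
  module _ (r : ℕ) (ω₂ : Ω l V n) where
    private
      γ₂ = proj₁ ω₂
      N₂ = proj₂ ω₂

    -- Monochromatic tuples are left alone: their bits do not show in `mask`, so the fibre could not
    -- restore them.
    Overwritten : ∀ {m} → Vec (Fin n) m → Set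
    Overwritten a = distinct a ≤ suc r × ¬ Mono γ₂ a

    overwritten? : ∀ {m} (a : Vec (Fin n) m) → Dec (Overwritten a)
    overwritten? a = (distinct a ≤? suc r) ×-dec ¬? (mono? γ₂ a)

    copy : Ω l V n → Ω l V n
    copy (_ , N) = γ₂ , tabulateˢ λ R a → if does (overwritten? a) then bit N₂ R a else bit N R a

    bit-copy-yes : ∀ (ω : Ω l V n) {m} (R : m ∈ V) a → Overwritten a → bit (proj₂ (copy ω)) R a ≡ bit N₂ R a
    bit-copy-yes (_ , N) R a o = trans (bit-tabulateˢ _ R a)
      (cong (λ b → if b then bit N₂ R a else bit N R a) (dec-true (overwritten? a) o))

    bit-copy-no : ∀ (ω : Ω l V n) {m} (R : m ∈ V) a → ¬ Overwritten a → bit (proj₂ (copy ω)) R a ≡ bit (proj₂ ω) R a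
    bit-copy-no (_ , N) R a ¬o = trans (bit-tabulateˢ _ R a)
      (cong (λ b → if b then bit N₂ R a else bit N R a) (dec-false (overwritten? a) ¬o))

    mask-copy : ∀ (ω : Ω l V n) → mask (copy ω) ↾ suc r ≡ mask ω₂ ↾ suc r
    mask-copy ω = mask-↾-ext (copy ω) ω₂ refl agree
      where
      agree : ∀ {m} (R : m ∈ V) a → distinct a ≤ suc r → bit (proper (copy ω)) R a ≡ bit (proper ω₂) R a
      agree R a ≤r with mono? γ₂ a
      ... | yes mono = trans (bit-mono γ₂ _ R a mono) (sym (bit-mono γ₂ N₂ R a mono))
      ... | no ¬mono = trans (bit-¬mono γ₂ (proj₂ (copy ω)) R a ¬mono)
        (trans (bit-copy-yes ω R a (≤r , ¬mono)) (sym (bit-¬mono γ₂ N₂ R a ¬mono)))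

    module _ (ω₁ : Ω l V n) (same : mask ω₁ ↾ r ≡ mask ω₂ ↾ r) where

      -- From level 1 on `ω₁` and `ω₂` have the same colouring. At level 0 they need not, but then
      -- nothing is overwritten: a tuple with at most one distinct element is constant.
      ¬mono₁ : ∀ {m} (a : Vec (Fin n) m) → Overwritten a → ¬ Mono (proj₁ ω₁) a
      ¬mono₁ a (≤r , ¬mono) = go r ≤r same
        where
        go : ∀ r → distinct a ≤ suc r → mask ω₁ ↾ r ≡ mask ω₂ ↾ r → ¬ Mono (proj₁ ω₁) a
        go zero    ≤1 _  = contradiction (λ p q → cong (lookup γ₂) (distinct≤1⇒≡ a ≤1 p q)) ¬mono
        go (suc r) _  eq = subst (λ γ → ¬ Mono γ a) (sym (colours-↾ ω₁ ω₂ eq)) ¬mono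

      -- `proper` keeps the bits of non-monochromatic tuples, so these can be read off the truncated
      -- structure shared by the whole fibre.
      fibre-known : ∀ (ω : Ω l V n) → mask ω ↾ suc r ≡ mask ω₁ ↾ suc r →
        ∀ {m} (R : m ∈ V) a → Overwritten a → bit (proj₂ ω) R a ≡ bit (proper ω₁) R a
      fibre-known ω@(γ , N) eq R a o with colours-↾ ω ω₁ eq
      ... | refl = trans (sym (bit-¬mono γ N R a (¬mono₁ a o))) (rels-↾ ω ω₁ eq R a (proj₁ o))

      copy-injective : ∀ {ω ω′ : Ω l V n} → mask ω ↾ suc r ≡ mask ω₁ ↾ suc r → mask ω′ ↾ suc r ≡ mask ω₁ ↾ suc r →
        copy ω ≡ copy ω′ → ω ≡ ω′
      copy-injective {ω} {ω′} eq eq′ copy≡ =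
        cong₂ _,_ (trans (colours-↾ ω ω₁ eq) (sym (colours-↾ ω′ ω₁ eq′))) (structure-ext agree)
        where
        agree : ∀ {m} (R : m ∈ V) a → bit (proj₂ ω) R a ≡ bit (proj₂ ω′) R a
        agree R a with overwritten? a
        ... | yes o = trans (fibre-known ω eq R a o) (sym (fibre-known ω′ eq′ R a o))
        ... | no ¬o = trans (sym (bit-copy-no ω R a ¬o))
          (trans (cong (λ ω → bit (proj₂ ω) R a) copy≡) (bit-copy-no ω′ R a ¬o))

      fibre-≤ : fibre (suc r) (mask ω₁ ↾ suc r) ≤ fibre (suc r) (mask ω₂ ↾ suc r)
      fibre-≤ = #-injection (λ ω → (mask ω ↾ suc r) ≟ˢ (mask ω₁ ↾ suc r)) (λ ω → (mask ω ↾ suc r) ≟ˢ (mask ω₂ ↾ suc r))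
        {f = copy} (outcomes-! l V n) ∈-outcomes copy-injective (λ {ω} _ → mask-copy ω)

  fibre-≡ : ∀ {r} (ω₁ ω₂ : Ω l V n) → mask ω₁ ↾ r ≡ mask ω₂ ↾ r →
    fibre (suc r) (mask ω₁ ↾ suc r) ≡ fibre (suc r) (mask ω₂ ↾ suc r)
  fibre-≡ {r} ω₁ ω₂ same = ℕ.≤-antisym (fibre-≤ r ω₂ ω₁ same) (fibre-≤ r ω₁ ω₂ (sym same))

  -- Induction on `r`. The fibre at level `r` splits into those over the extensions in `F`, all of
  -- equal size by `fibre-≡`, so dividing by the length of `F` leaves the share of one extension.
  ℙ-mask : ∀ r (ω : Ω l V n) → ℙ l V n r (mask ω ↾ r) ≡ ι (fibre r (mask ω ↾ r)) ℚ.* w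
  ℙ-mask zero ω = begin
    1ℚ ÷ length (𝐊↾ l V n 0)         ≡⟨ cong (1ℚ ÷_) (length≡1 (𝐊↾-! 0) (∈𝐊↾⁺ 0 ω) all-equal) ⟩
    1ℚ                               ≡⟨ size*w ⟨
    ι size ℚ.* w                     ≡⟨ cong (λ c → ι c ℚ.* w) (cong length
                                          (filter-all (λ ω′ → (mask ω′ ↾ 0) ≟ˢ (mask ω ↾ 0)) {xs = outcomes l V n}
                                            (All.tabulate λ {ω′} _ → ↾0-≡ (mask ω′) (mask ω)))) ⟨
    ι (fibre 0 (mask ω ↾ 0)) ℚ.* w   ∎
    where
    open ≡-Reasoning
    all-equal : ∀ {B} → B ∈ 𝐊↾ l V n 0 → B ≡ mask ω ↾ 0
    all-equal B∈ with ω′ , refl ← ∈𝐊↾⁻ {0} B∈ = ↾0-≡ (mask ω′) (mask ω)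
  ℙ-mask (suc r) ω = begin
    ℙ l V n r (B₀ ↾ r) ÷ length F                  ≡⟨ cong (λ C → ℙ l V n r C ÷ length F) B₀↾r ⟩
    ℙ l V n r (mask ω ↾ r) ÷ length F             ≡⟨ cong (_÷ length F) (ℙ-mask r ω) ⟩
    (ι (fibre r (mask ω ↾ r)) ℚ.* w) ÷ length F   ≡⟨ cong (λ c → (ι c ℚ.* w) ÷ length F) fibres ⟩
    (ι (length F * c) ℚ.* w) ÷ length F           ≡⟨ cong (λ q → (q ℚ.* w) ÷ length F) (ι-* (length F) c) ⟩
    (ι (length F) ℚ.* ι c ℚ.* w) ÷ length F       ≡⟨ cong (_÷ length F) (ℚ.*-assoc (ι (length F)) (ι c) w) ⟩
    (ι (length F) ℚ.* (ι c ℚ.* w)) ÷ length F     ≡⟨ ÷-cancelˡ (length F) {{F≢0 B₀∈F}} (ι c ℚ.* w) ⟩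
    ι c ℚ.* w                                     ∎
    where
    open ≡-Reasoning
    B₀ = mask ω ↾ suc r
    c = fibre (suc r) B₀
    over? : Decidable (λ B′ → (B′ ↾ r) ≡ (B₀ ↾ r))
    over? B′ = (B′ ↾ r) ≟ˢ (B₀ ↾ r)
    F = filter over? (𝐊↾ l V n (suc r))
    B₀↾r : B₀ ↾ r ≡ mask ω ↾ r
    B₀↾r = ↾-↾ (mask ω) (ℕ.n≤1+n r)
    B₀∈F : B₀ ∈ F
    B₀∈F = ∈-filter⁺ over? (∈𝐊↾⁺ (suc r) ω) refl
    F≢0 : ∀ {xs} → B₀ ∈ xs → NonZero (length xs)
    F≢0 {_ ∷ _} _ = nonZero
    F⁻ : ∀ {B′} → B′ ∈ F → Σ (Ω l V n) λ ω′ → B′ ≡ mask ω′ ↾ suc r × mask ω′ ↾ r ≡ mask ω ↾ r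
    F⁻ {B′} B′∈ = preimage (∈-filter⁻ over? {xs = 𝐊↾ l V n (suc r)} B′∈)
      where
      preimage : B′ ∈ 𝐊↾ l V n (suc r) × (B′ ↾ r) ≡ (B₀ ↾ r) →
        Σ (Ω l V n) λ ω′ → B′ ≡ mask ω′ ↾ suc r × mask ω′ ↾ r ≡ mask ω ↾ r
      preimage (B′∈𝐊↾ , over) = ω′ , eq ,
        trans (sym (↾-↾ (mask ω′) (ℕ.n≤1+n r))) (trans (cong (_↾ r) (sym eq)) (trans over B₀↾r))
        where
        ω′ = proj₁ (∈𝐊↾⁻ {suc r} B′∈𝐊↾)
        eq = proj₂ (∈𝐊↾⁻ {suc r} B′∈𝐊↾)
    fibres : fibre r (mask ω ↾ r) ≡ length F * c
    fibres = begin
      fibre r (mask ω ↾ r)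
        ≡⟨ #-cong (λ ω′ → (mask ω′ ↾ r) ≟ˢ (mask ω ↾ r)) (λ ω′ → (mask ω′ ↾ suc r) ∈? F) to from (outcomes l V n) ⟩
      # (λ ω′ → (mask ω′ ↾ suc r) ∈? F) (outcomes l V n)
        ≡⟨ Σ#-fibres _≟ˢ_ (λ ω′ → mask ω′ ↾ suc r) (outcomes l V n) (UniqueList.filter⁺ over? (𝐊↾-! (suc r))) ⟨
      sum (List.map (fibre (suc r)) F)
        ≡⟨ sum-const (fibre (suc r)) c F equal ⟩
      length F * c ∎
      where
      to : ∀ (ω′ : Ω l V n) → mask ω′ ↾ r ≡ mask ω ↾ r → mask ω′ ↾ suc r ∈ F
      to ω′ eq = ∈-filter⁺ over? (∈𝐊↾⁺ (suc r) ω′)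
        (trans (↾-↾ (mask ω′) (ℕ.n≤1+n r)) (trans eq (sym B₀↾r)))
      from : ∀ (ω′ : Ω l V n) → mask ω′ ↾ suc r ∈ F → mask ω′ ↾ r ≡ mask ω ↾ r
      from ω′ ∈F = trans (sym (↾-↾ (mask ω′) (ℕ.n≤1+n r)))
        (trans (proj₂ (∈-filter⁻ over? {xs = 𝐊↾ l V n (suc r)} ∈F)) B₀↾r)
      equal : ∀ {B′} → B′ ∈ F → fibre (suc r) B′ ≡ c
      equal B′∈ = trans (cong (fibre (suc r)) (proj₁ (proj₂ (F⁻ B′∈))))
        (fibre-≡ (proj₁ (F⁻ B′∈)) ω (proj₂ (proj₂ (F⁻ B′∈))))

  -- At level `ρ` truncation is the identity, so the point mass of `M` counts the outcomes with mask
  -- `M`; the masses of the chosen `M` then add up to a count of outcomes.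
  δᴷ-uniform : ∀ {X : Pred (Structure (L l V) n) 0ℓ} (X? : Decidable X) →
    δᴷ l V n X? ≡ ι (# (X? ∘ mask) (outcomes l V n)) ℚ.* w
  δᴷ-uniform X? = begin
    sumℚ (List.map (ℙ l V n r) F)
      ≡⟨ sumℚ-ι (ℙ l V n r) (λ M → # (λ ω → mask ω ≟ˢ M) (outcomes l V n)) w F point ⟩
    ι (sum (List.map (λ M → # (λ ω → mask ω ≟ˢ M) (outcomes l V n)) F)) ℚ.* w
      ≡⟨ cong (λ c → ι c ℚ.* w) (trans
           (Σ#-fibres _≟ˢ_ mask (outcomes l V n) (UniqueList.filter⁺ X? (UniqueList.filter⁺ (in𝐊? l V n) (structures-! (L l V) n))))
           (#-cong (λ ω → mask ω ∈? F) (X? ∘ mask)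
             (λ _ ∈F → proj₂ (∈-filter⁻ X? {xs = 𝐊 l V n} ∈F)) (λ ω Xω → ∈-filter⁺ X? (∈𝐊⁺ ω) Xω) (outcomes l V n))) ⟩
    ι (# (X? ∘ mask) (outcomes l V n)) ℚ.* w ∎
    where
    open ≡-Reasoning
    r = ρ (L l V)
    F = filter X? (𝐊 l V n)
    point : ∀ {M} → M ∈ F → ℙ l V n r M ≡ ι (# (λ ω → mask ω ≟ˢ M) (outcomes l V n)) ℚ.* w
    point {M} M∈ = subst (λ M → ℙ l V n r M ≡ ι (# (λ ω → mask ω ≟ˢ M) (outcomes l V n)) ℚ.* w) (sym (proj₂ source))
      (pointMask (proj₁ source))
      where
      source : Σ (Ω l V n) λ ω → M ≡ mask ω
      source = ∈𝐊⁻ (proj₁ (∈-filter⁻ X? {xs = 𝐊 l V n} M∈))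
      pointMask : ∀ (ω : Ω l V n) → ℙ l V n r (mask ω) ≡ ι (# (λ ω′ → mask ω′ ≟ˢ mask ω) (outcomes l V n)) ℚ.* w
      pointMask ω = begin
        ℙ l V n r (mask ω)                 ≡⟨ cong (ℙ l V n r) (↾ρ-≡ (mask ω)) ⟨
        ℙ l V n r (mask ω ↾ r)             ≡⟨ ℙ-mask r ω ⟩
        ι (fibre r (mask ω ↾ r)) ℚ.* w     ≡⟨ cong (λ c → ι c ℚ.* w)
          (#-cong (λ ω′ → (mask ω′ ↾ r) ≟ˢ (mask ω ↾ r)) (λ ω′ → mask ω′ ≟ˢ mask ω)
            (λ ω′ eq → trans (sym (↾ρ-≡ (mask ω′))) (trans eq (↾ρ-≡ (mask ω)))) (λ _ → cong (_↾ r)) (outcomes l V n)) ⟩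
        ι (# (λ ω′ → mask ω′ ≟ˢ mask ω) (outcomes l V n)) ℚ.* w ∎

-- Extension properties of random outcomes

anyVec? : ∀ {n m} {P : Pred (Vec (Fin n) m) 0ℓ} → Decidable P → Dec (∃[ a ] P a)
anyVec? {m = zero}  P? = map′ (λ p → [] , p) (λ { ([] , p) → p }) (P? [])
anyVec? {m = suc m} P? =
  map′ (λ { (x , a , p) → x ∷ a , p }) (λ { (x ∷ a , p) → x , a , p })
       (any? λ x → anyVec? λ a → P? (x ∷ a))

InjectiveVec : ∀ {n d} → Vec (Fin n) d → Set
InjectiveVec w = ∀ i j → lookup w i ≡ lookup w j → i ≡ j

map-lookup-injective : ∀ {n d m} {w : Vec (Fin n) d} → InjectiveVec w →
  {a b : Vec (Fin d) m} → Vec.map (lookup w) a ≡ Vec.map (lookup w) b → a ≡ b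
map-lookup-injective {w = w} w-inj {a} {b} eq = lookup-ext λ p → w-inj _ _
  (trans (sym (lookup-mapⱽ p (lookup w) a)) (trans (cong (λ v → lookup v p) eq) (lookup-mapⱽ p (lookup w) b)))

lookup-injective : ∀ {A : Set} {xs : List A} → UniqueList.Unique xs → ∀ i j →
  List.lookup xs i ≡ List.lookup xs j → i ≡ j
lookup-injective (_ ∷ _)    zero    zero    _  = refl
lookup-injective (x∉ ∷ _)   zero    (suc j) eq = contradiction eq (All.lookup x∉ (∈-lookup j))
lookup-injective (x∉ ∷ _)   (suc i) zero    eq = contradiction (sym eq) (All.lookup x∉ (∈-lookup i))
lookup-injective (_ ∷ xs!)  (suc i) (suc j) eq = cong suc (lookup-injective xs! i j eq)

choose : {A B : Set} → (A → B) → Dec A → B → B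
choose f (yes a) _ = f a
choose f (no _)  b = b

-- The witness inside `A?` need not be the one at hand, so the value must not depend on it.
choose-yes : {A B : Set} (f : A → B) (A? : Dec A) {b c : B} → A → (∀ a → f a ≡ c) → choose f A? b ≡ c
choose-yes f (yes a) _ eq = eq a
choose-yes f (no ¬a) a _  = contradiction a ¬a

choose-no : {A B : Set} (f : A → B) (A? : Dec A) {b : B} → ¬ A → choose f A? b ≡ b
choose-no f (yes a) ¬a = contradiction a ¬a
choose-no f (no _)  _  = refl

-- `y` occupies at most `d` elements; the remaining ones are cut into `m` rows of length `d` by
-- `combine`.
freshBlocks : ∀ {n d} (y : Vec (Fin n) d) m → d + m * d ≤ n →
  Σ (Fin m → Fin d → Fin n) λ g →
    (∀ i j i′ j′ → g i j ≡ g i′ j′ → i ≡ i′ × j ≡ j′) × (∀ i j k → lookup y k ≢ g i j)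
freshBlocks {n} {d} y m d+md≤n =
  (λ i j → f (combine i j)) ,
  (λ i j i′ j′ eq → combine-injective i j i′ j′ (inject≤-injective le le _ _ (lookup-injective xs! _ _ eq))) ,
  (λ i j k eq → proj₂ (∈-filter⁻ (¬? ∘ inside?) {xs = List.allFin n} (∈-lookup (inject≤ (combine i j) le))) (k , eq))
  where
  inside? : Decidable (λ x → ∃[ k ] lookup y k ≡ x)
  inside? x = any? λ k → lookup y k ≟ᶠ x
  xs = filter (¬? ∘ inside?) (List.allFin n)
  xs! : UniqueList.Unique xs
  xs! = UniqueList.filter⁺ (¬? ∘ inside?) (UniqueList.allFin⁺ n)
  inside≤ : # inside? (List.allFin n) ≤ d
  inside≤ = ℕ.≤-trans
    (length-injection {f = id} {ys = List.map (lookup y) (List.allFin d)} (UniqueList.filter⁺ inside? (UniqueList.allFin⁺ n)) (λ _ _ → id)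
      (λ x∈ → let (k , eq) = proj₂ (∈-filter⁻ inside? {xs = List.allFin n} x∈) in
        subst (_∈ List.map (lookup y) (List.allFin d)) eq (∈-map⁺ (lookup y) (∈-allFin k))))
    (ℕ.≤-reflexive (trans (length-map (lookup y) (List.allFin d)) (length-tabulate id)))
  le : m * d ≤ length xs
  le = ℕ.+-cancelˡ-≤ d _ _ (begin
    d + m * d                                  ≤⟨ d+md≤n ⟩
    n                                          ≡⟨ length-tabulate {n = n} id ⟨
    length (List.allFin n)                     ≡⟨ #-complement inside? (List.allFin n) ⟨
    # inside? (List.allFin n) + length xs      ≤⟨ ℕ.+-monoˡ-≤ (length xs) inside≤ ⟩
    d + length xs                              ∎)
    where open ≤-Reasoning
  f : Fin (m * d) → Fin n
  f i = List.lookup xs (inject≤ i le)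

-- `New` is a predicate because the new points are the first ones when `D` is `𝒮` and the last ones
-- when `D` is `𝓑`.
module Extension (l : ℕ) (V : Vocabulary) {d : ℕ} (D : Structure V d) {New : Pred (Fin d) 0ℓ} (New? : Decidable New) where

  Touches : ∀ {m} → Vec (Fin d) m → Set
  Touches a = ∃[ p ] New (lookup a p)

  touches? : ∀ {m} (a : Vec (Fin d) m) → Dec (Touches a)
  touches? a = any? λ p → New? (lookup a p)

  -- Bounds the number of values of `pullback`, independently of `n`; the `suc` makes it nonzero.
  q : ℕ
  q = suc (length (outcomes l V d))

  module _ {n : ℕ} where

    -- Stated for the raw relations `N`, whose bits can be set independently of the colours;
    -- `good⇒embeds` passes to `proper`.
    Good : Vec (Fin l) d → Vec (Fin n) d → Ω l V n → Set
    Good γ′ w (γ , N) =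
      (∀ i → New i → lookup γ (lookup w i) ≡ lookup γ′ i) ×
      (∀ {m} (R : m ∈ V) a → Touches a → bit N R (Vec.map (lookup w) a) ≡ bit D R a)

    good? : ∀ γ′ w → Decidable (Good γ′ w)
    good? γ′ w (γ , N) =
      (all? λ i → New? i →-dec (lookup γ (lookup w i) ≟ᶠ lookup γ′ i)) ×-dec
      (allSymbol? λ R → allVec? λ a → touches? a →-dec (bit N R (Vec.map (lookup w) a) ≟ᴮ bit D R a))

    -- Only the values of y outside New are relevant.
    InjectiveOld : Vec (Fin n) d → Set
    InjectiveOld y = ∀ i j → ¬ New i → ¬ New j → lookup y i ≡ lookup y j → i ≡ j

    injectiveOld? : Decidable InjectiveOld
    injectiveOld? y = all? λ i → all? λ j →
      ¬? (New? i) →-dec (¬? (New? j) →-dec ((lookup y i ≟ᶠ lookup y j) →-dec (i ≟ᶠ j)))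

    Extends : Vec (Fin n) d → Vec (Fin n) d → Set
    Extends y w = ∀ i → ¬ New i → lookup w i ≡ lookup y i

    Extendable : Vec (Fin l) d → Vec (Fin n) d → Ω l V n → Set
    Extendable γ′ y ω = ∃[ w ] (Extends y w × InjectiveVec w × Good γ′ w ω)

    extendable? : ∀ γ′ y → Decidable (Extendable γ′ y)
    extendable? γ′ y ω = anyVec? λ w →
      (all? λ i → ¬? (New? i) →-dec (lookup w i ≟ᶠ lookup y i)) ×-dec
      ((all? λ i → all? λ j → (lookup w i ≟ᶠ lookup w j) →-dec (i ≟ᶠ j)) ×-dec
      good? γ′ w ω)

    Rich : Ω l V n → Set
    Rich ω = ∀ γ′ y → InjectiveOld y → Extendable γ′ y ω

    rich? : Decidable Rich
    rich? ω = allVec? λ γ′ → allVec? λ y → injectiveOld? y →-dec extendable? γ′ y ω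

    -- Remembers everything that `overwrite` can destroy, within a type whose size does not grow
    -- with `n`.
    pullback : Vec (Fin n) d → Ω l V n → Ω l V d
    pullback w (γ , N) = tabulate (λ i → lookup γ (lookup w i)) , tabulateˢ λ R a → bit N R (Vec.map (lookup w) a)

    Fresh : Vec (Fin n) d → Vec (Fin n) d → Set
    Fresh w w′ = ∀ i j → New j → lookup w i ≢ lookup w′ j

    AllFail : ∀ {m} → Vec (Fin l) d → (Fin m → Vec (Fin n) d) → List (Fin m) → Ω l V n → Set
    AllFail γ′ W is ω = All (λ i → ¬ Good γ′ (W i) ω) is

    allFail? : ∀ {m} γ′ (W : Fin m → Vec (Fin n) d) is → Decidable (AllFail γ′ W is)
    allFail? γ′ W is ω = All.all? (λ i → ¬? (good? γ′ (W i) ω)) is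

    module _ (γ′ : Vec (Fin l) d) (w : Vec (Fin n) d) (w-inj : InjectiveVec w) where

      HitBy : Fin n → Set
      HitBy x = ∃[ i ] (New i × lookup w i ≡ x)

      hitBy? : Decidable HitBy
      hitBy? x = any? λ i → New? i ×-dec (lookup w i ≟ᶠ x)

      HitByTuple : ∀ {m} → Vec (Fin n) m → Set
      HitByTuple b = ∃[ a ] (Touches a × Vec.map (lookup w) a ≡ b)

      hitByTuple? : ∀ {m} (b : Vec (Fin n) m) → Dec (HitByTuple b)
      hitByTuple? b = anyVec? λ a → touches? a ×-dec ≡-dec _≟ᶠ_ (Vec.map (lookup w) a) b

      opaque
        overwrite : Ω l V n → Ω l V n
        overwrite (γ , N) =
          tabulate (λ x → choose (λ (i , _) → lookup γ′ i) (hitBy? x) (lookup γ x)) ,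
          tabulateˢ λ R b → choose (λ (a , _) → bit D R a) (hitByTuple? b) (bit N R b)

        colour-hit : ∀ ω i → New i → lookup (proj₁ (overwrite ω)) (lookup w i) ≡ lookup γ′ i
        colour-hit ω i new = trans (lookup∘tabulate _ (lookup w i))
          (choose-yes _ (hitBy? (lookup w i)) (i , new , refl) λ { (j , _ , eq) → cong (lookup γ′) (w-inj j i eq) })

        colour-unhit : ∀ ω x → ¬ HitBy x → lookup (proj₁ (overwrite ω)) x ≡ lookup (proj₁ ω) x
        colour-unhit ω x ¬hit = trans (lookup∘tabulate _ x) (choose-no _ (hitBy? x) ¬hit)

        bit-hit : ∀ ω {m} (R : m ∈ V) a → Touches a → bit (proj₂ (overwrite ω)) R (Vec.map (lookup w) a) ≡ bit D R a
        bit-hit ω R a touches = trans (bit-tabulateˢ _ R (Vec.map (lookup w) a))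
          (choose-yes _ (hitByTuple? (Vec.map (lookup w) a)) (a , touches , refl)
            λ { (b , _ , eq) → cong (bit D R) (map-lookup-injective {w = w} w-inj eq) })

        bit-unhit : ∀ ω {m} (R : m ∈ V) b → ¬ HitByTuple b → bit (proj₂ (overwrite ω)) R b ≡ bit (proj₂ ω) R b
        bit-unhit ω R b ¬hit = trans (bit-tabulateˢ _ R b) (choose-no _ (hitByTuple? b) ¬hit)

      overwrite-good : ∀ ω → Good γ′ w (overwrite ω)
      overwrite-good ω = colour-hit ω , bit-hit ω

      -- Data at points and tuples hit by `w` survive in the pullback, all other data in the
      -- overwritten outcome.
      overwrite-pullback-injective : ∀ ω ω′ → overwrite ω ≡ overwrite ω′ → pullback w ω ≡ pullback w ω′ → ω ≡ ω′
      overwrite-pullback-injective ω@(γ , N) ω′@(γ″ , N′) over≡ pull≡ = cong₂ _,_ (lookup-ext colours) (structure-ext bits)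
        where
        colours : ∀ x → lookup γ x ≡ lookup γ″ x
        colours x with hitBy? x
        ... | yes (i , _ , refl) = trans (sym (lookup∘tabulate _ i))
          (trans (cong (λ ω → lookup (proj₁ ω) i) pull≡) (lookup∘tabulate _ i))
        ... | no ¬hit = trans (sym (colour-unhit ω x ¬hit))
          (trans (cong (λ ω → lookup (proj₁ ω) x) over≡) (colour-unhit ω′ x ¬hit))
        bits : ∀ {m} (R : m ∈ V) b → bit N R b ≡ bit N′ R b
        bits R b with hitByTuple? b
        ... | yes (a , _ , refl) = trans (sym (bit-tabulateˢ _ R a))
          (trans (cong (λ ω → bit (proj₂ ω) R a) pull≡) (bit-tabulateˢ _ R a))
        ... | no ¬hit = trans (sym (bit-unhit ω R b ¬hit))
          (trans (cong (λ ω → bit (proj₂ ω) R b) over≡) (bit-unhit ω′ R b ¬hit))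

      -- A tuple touching a new point of `w′` contains an element outside the range of `w`, so it is
      -- no image of a tuple along `w`.
      good-unaffected : ∀ w′ → Fresh w w′ → ∀ ω → Good γ′ w′ (overwrite ω) → Good γ′ w′ ω
      good-unaffected w′ fresh ω (colours , bits) =
        (λ j new → trans (sym (colour-unhit ω (lookup w′ j) λ { (i , _ , eq) → fresh i j new eq })) (colours j new)) ,
        (λ R a touches@(p , new) → trans
          (sym (bit-unhit ω R (Vec.map (lookup w′) a) λ { (b , _ , eq) → fresh (lookup b p) (lookup a p) new
            (trans (sym (lookup-mapⱽ p (lookup w) b)) (trans (cong (λ v → lookup v p) eq) (lookup-mapⱽ p (lookup w′) a))) }))
          (bits R a touches))

    module _ (γ′ : Vec (Fin l) d) {m : ℕ} (W : Fin m → Vec (Fin n) d) (W-inj : ∀ i → InjectiveVec (W i))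
             (W-fresh : ∀ i j → i ≢ j → Fresh (W i) (W j)) where

      private
        T′ = length (outcomes l V n)

      -- Overwriting block `i`, paired with the pullback, injects the outcomes failing on `is` into
      -- pairs of such an outcome that is good at `i` and one of fewer than q+1 pullbacks. So at
      -- least 1/(q+1) of them are good at `i`, and at most q/(q+1) fail there as well.
      fail-step : ∀ i is → All (i ≢_) is →
        suc q * # (allFail? γ′ W (i ∷ is)) (outcomes l V n) ≤ q * # (allFail? γ′ W is) (outcomes l V n)
      fail-step i is i∉is = ℕ.+-cancelʳ-≤ (suc q * g) _ _ (begin
        suc q * b′ + suc q * g   ≡⟨ solve 3 (λ q b g → q :* b :+ q :* g := q :* (g :+ b)) refl (suc q) b′ g ⟩
        suc q * (g + b′)         ≡⟨ cong (suc q *_) b≡ ⟨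
        suc q * b                ≡⟨ ℕ.+-comm b (q * b) ⟩
        q * b + b                ≤⟨ ℕ.+-monoʳ-≤ (q * b) b≤ ⟩
        q * b + suc q * g        ∎)
        where
        open ≤-Reasoning
        open +-*-Solver
        Gᵢ? : Decidable (λ ω → AllFail γ′ W is ω × Good γ′ (W i) ω)
        Gᵢ? ω = allFail? γ′ W is ω ×-dec good? γ′ (W i) ω
        b b′ g : ℕ
        b  = # (allFail? γ′ W is) (outcomes l V n)
        b′ = # (allFail? γ′ W (i ∷ is)) (outcomes l V n)
        g  = # Gᵢ? (outcomes l V n)
        b≡ : b ≡ g + b′
        b≡ = #-⊎ (allFail? γ′ W is) Gᵢ? (allFail? γ′ W (i ∷ is)) (λ ω → mk⇔ (to ω) λ { (inj₁ (p , _)) → p ; (inj₂ (_ ∷ p)) → p })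
          (λ { ω (_ , good) (¬good ∷ _) → ¬good good }) (outcomes l V n)
          where
          to : ∀ ω → AllFail γ′ W is ω → (AllFail γ′ W is ω × Good γ′ (W i) ω) ⊎ AllFail γ′ W (i ∷ is) ω
          to ω p with good? γ′ (W i) ω
          ... | yes good = inj₁ (p , good)
          ... | no ¬good = inj₂ (¬good ∷ p)
        b≤ : b ≤ suc q * g
        b≤ = begin
          b                                  ≤⟨ length-injection {f = λ ω → overwrite γ′ (W i) (W-inj i) ω , pullback (W i) ω}
                                                 {ys = cartesianProduct (filter Gᵢ? (outcomes l V n)) (outcomes l V d)}
                                                 (UniqueList.filter⁺ (allFail? γ′ W is) (outcomes-! l V n))
                                                 (λ _ _ eq → overwrite-pullback-injective γ′ (W i) (W-inj i) _ _ (cong proj₁ eq) (cong proj₂ eq))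
                                                 (λ {ω} ω∈ → ∈-cartesianProduct⁺
                                                   (∈-filter⁺ Gᵢ? (∈-outcomes (overwrite γ′ (W i) (W-inj i) ω))
                                                     (stillFail ω (proj₂ (∈-filter⁻ (allFail? γ′ W is) {xs = outcomes l V n} ω∈)) ,
                                                      overwrite-good γ′ (W i) (W-inj i) ω))
                                                   (∈-outcomes (pullback (W i) ω))) ⟩
          length (cartesianProduct (filter Gᵢ? (outcomes l V n)) (outcomes l V d))
                                             ≡⟨ length-cartesianProductWith _,_ (filter Gᵢ? (outcomes l V n)) (outcomes l V d) ⟩
          g * length (outcomes l V d)        ≤⟨ ℕ.*-monoʳ-≤ g (ℕ.≤-trans (ℕ.n≤1+n _) (ℕ.n≤1+n _)) ⟩
          g * suc q                          ≡⟨ ℕ.*-comm g (suc q) ⟩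
          suc q * g                          ∎
          where
          stillFail : ∀ ω → AllFail γ′ W is ω → AllFail γ′ W is (overwrite γ′ (W i) (W-inj i) ω)
          stillFail ω fails = All.tabulate λ {j} j∈ good →
            All.lookup fails j∈ (good-unaffected γ′ (W i) (W-inj i) (W j) (W-fresh i j (All.lookup i∉is j∈)) ω good)

      fail-decay : ∀ {is} → UniqueList.Unique is →
        # (allFail? γ′ W is) (outcomes l V n) * suc q ^ length is ≤ q ^ length is * T′
      fail-decay {[]} [] = ℕ.≤-trans (ℕ.≤-reflexive (ℕ.*-identityʳ _))
        (ℕ.≤-trans (length-filter (allFail? γ′ W []) (outcomes l V n)) (ℕ.≤-reflexive (sym (ℕ.+-identityʳ T′))))
      fail-decay {i ∷ is} (i∉is ∷ is!) = begin
        b′ * (suc q * suc q ^ k)   ≡⟨ solve 3 (λ b q X → b :* (q :* X) := (q :* b) :* X) refl b′ (suc q) (suc q ^ k) ⟩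
        suc q * b′ * suc q ^ k     ≤⟨ ℕ.*-monoˡ-≤ (suc q ^ k) (fail-step i is i∉is) ⟩
        q * b * suc q ^ k          ≡⟨ ℕ.*-assoc q b (suc q ^ k) ⟩
        q * (b * suc q ^ k)        ≤⟨ ℕ.*-monoʳ-≤ q (fail-decay is!) ⟩
        q * (q ^ k * T′)           ≡⟨ ℕ.*-assoc q (q ^ k) T′ ⟨
        q * q ^ k * T′             ∎
        where
        open ≤-Reasoning
        open +-*-Solver
        k = length is
        b = # (allFail? γ′ W is) (outcomes l V n)
        b′ = # (allFail? γ′ W (i ∷ is)) (outcomes l V n)

    merge : Vec (Fin n) d → (Fin d → Fin n) → Vec (Fin n) d
    merge y g = tabulate λ i → if does (New? i) then g i else lookup y i

    lookup-merge : ∀ y g i → (New i × lookup (merge y g) i ≡ g i) ⊎ (¬ New i × lookup (merge y g) i ≡ lookup y i)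
    lookup-merge y g i rewrite lookup∘tabulate (λ i → if does (New? i) then g i else lookup y i) i with New? i
    ... | yes new = inj₁ (new , refl)
    ... | no ¬new = inj₂ (¬new , refl)

    merge-old : ∀ y g → Extends y (merge y g)
    merge-old y g i ¬new with lookup-merge y g i
    ... | inj₁ (new , _) = contradiction new ¬new
    ... | inj₂ (_ , eq)  = eq

    merge-new : ∀ y g i → New i → lookup (merge y g) i ≡ g i
    merge-new y g i new with lookup-merge y g i
    ... | inj₁ (_ , eq)   = eq
    ... | inj₂ (¬new , _) = contradiction new ¬new

    unextendable-bound : ∀ γ′ y → InjectiveOld y → ∀ m → d + m * d ≤ n →
      # (¬? ∘ extendable? γ′ y) (outcomes l V n) * suc q ^ m ≤ q ^ m * length (outcomes l V n)
    unextendable-bound γ′ y y-inj m d+md≤n with freshBlocks y m d+md≤n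
    ... | g , g-inj , g-avoids-y = ℕ.≤-trans
      (ℕ.*-monoˡ-≤ (suc q ^ m) (#-mono (¬? ∘ extendable? γ′ y) (allFail? γ′ W (List.allFin m)) fails (outcomes l V n)))
      (subst (λ k → # (allFail? γ′ W (List.allFin m)) (outcomes l V n) * suc q ^ k ≤ q ^ k * length (outcomes l V n))
        (length-tabulate {n = m} id) (fail-decay γ′ W W-inj W-fresh (UniqueList.allFin⁺ m)))
      where
      W : Fin m → Vec (Fin n) d
      W i = merge y (g i)
      W-inj : ∀ i → InjectiveVec (W i)
      W-inj i j k eq with lookup-merge y (g i) j | lookup-merge y (g i) k
      ... | inj₁ (_ , eqⱼ)  | inj₁ (_ , eqₖ)  = proj₂ (g-inj i j i k (trans (sym eqⱼ) (trans eq eqₖ)))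
      ... | inj₁ (_ , eqⱼ)  | inj₂ (_ , eqₖ)  = contradiction (trans (sym eqₖ) (trans (sym eq) eqⱼ)) (g-avoids-y i j k)
      ... | inj₂ (_ , eqⱼ)  | inj₁ (_ , eqₖ)  = contradiction (trans (sym eqⱼ) (trans eq eqₖ)) (g-avoids-y i k j)
      ... | inj₂ (¬j , eqⱼ) | inj₂ (¬k , eqₖ) = y-inj j k ¬j ¬k (trans (sym eqⱼ) (trans eq eqₖ))
      W-fresh : ∀ i j → i ≢ j → Fresh (W i) (W j)
      W-fresh i j i≢j k k′ new eq with lookup-merge y (g i) k
      ... | inj₁ (_ , eqₖ) = i≢j (proj₁ (g-inj i k j k′ (trans (sym eqₖ) (trans eq (merge-new y (g j) k′ new)))))
      ... | inj₂ (_ , eqₖ) = g-avoids-y j k′ k (trans (sym eqₖ) (trans eq (merge-new y (g j) k′ new)))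
      fails : ∀ ω → ¬ Extendable γ′ y ω → AllFail γ′ W (List.allFin m) ω
      fails ω ¬ext = All.tabulate λ {i} _ good → ¬ext (W i , merge-old y (g i) , W-inj i , good)

    -- Union bound over at most l^d · n^d pairs of a colour pattern and an old vector, each with its
    -- own `m` blocks.
    poor-bound : ∀ m → d + m * d ≤ n →
      # (¬? ∘ rich?) (outcomes l V n) * suc q ^ m ≤ l ^ d * n ^ d * (q ^ m * length (outcomes l V n))
    poor-bound m d+md≤n = ℕ.≤-trans
      (#-union-bound (λ (γ′ , y) → ¬? ∘ extendable? γ′ y) tasks {outcomes l V n} (suc q ^ m) _
        (λ {t} t∈ → unextendable-bound (proj₁ t) (proj₂ t) (proj₂ (∈-filter⁻ injectiveOld? {xs = vecs (List.allFin n) d}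
                  (proj₂ (∈-cartesianProduct⁻ (vecs (List.allFin l) d) olds t∈)))) m d+md≤n)
        (¬? ∘ rich?) (λ ω → covers ω))
      (ℕ.*-monoˡ-≤ _ tasks≤)
      where
      olds : List (Vec (Fin n) d)
      olds = filter injectiveOld? (vecs (List.allFin n) d)
      tasks : List (Vec (Fin l) d × Vec (Fin n) d)
      tasks = cartesianProduct (vecs (List.allFin l) d) olds
      length-vecs-allFin : ∀ k → length (vecs (List.allFin k) d) ≡ k ^ d
      length-vecs-allFin k = trans (length-vecs (List.allFin k) d) (cong (_^ d) (length-tabulate {n = k} id))
      tasks≤ : length tasks ≤ l ^ d * n ^ d
      tasks≤ = begin
        length tasks                                   ≡⟨ length-cartesianProductWith _,_ (vecs (List.allFin l) d) olds ⟩
        length (vecs (List.allFin l) d) * length olds  ≤⟨ ℕ.*-mono-≤ (ℕ.≤-reflexive (length-vecs-allFin l))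
                                                            (ℕ.≤-trans (length-filter injectiveOld? (vecs (List.allFin n) d)) (ℕ.≤-reflexive (length-vecs-allFin n))) ⟩
        l ^ d * n ^ d                                  ∎
        where open ≤-Reasoning
      covers : ∀ ω → ¬ Rich ω → ∃[ t ] (t ∈ tasks × ¬ Extendable (proj₁ t) (proj₂ t) ω)
      -- The failing pair is found by search, since constructively a refuted universal statement
      -- does not yield a counterexample by itself.
      covers ω ¬rich with Any.any? (λ t → ¬? (extendable? (proj₁ t) (proj₂ t) ω)) tasks
      ... | yes found = let (t , t∈ , ¬ext) = find found in t , t∈ , ¬ext
      ... | no none = contradiction (λ γ′ y y-inj → decidable-stable (extendable? γ′ y ω) λ ¬ext →
        none (lose (∈-cartesianProduct⁺ (∈-vecs ∈-allFin γ′) (∈-filter⁺ injectiveOld? (∈-vecs ∈-allFin y) y-inj)) ¬ext)) ¬rich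

  poor-negligible : .{{_ : NonZero d}} → (∀ n → 0 < length (outcomes l V n)) →
    Negligible (λ n → # (¬? ∘ rich?) (outcomes l V n)) (λ n → length (outcomes l V n))
  poor-negligible T>0 = negligible _ _ d (l ^ d) q T>0 (λ n m → poor-bound m)

-- Semantics of the formulas

module _ {V : Vocabulary} {n : ℕ} (M : Structure V n) where

  ⋀⁺ : ∀ {k} (φs : List (Formula V k)) {e} → All (λ φ → M ⊨ φ [ e ]) φs → M ⊨ ⋀ φs [ e ]
  ⋀⁺ []       []       = tt
  ⋀⁺ (_ ∷ φs) (p ∷ ps) = p , ⋀⁺ φs ps

  ⋀⁻ : ∀ {k} (φs : List (Formula V k)) {e} → M ⊨ ⋀ φs [ e ] → All (λ φ → M ⊨ φ [ e ]) φs
  ⋀⁻ []       _        = []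
  ⋀⁻ (_ ∷ φs) (p , ps) = p ∷ ⋀⁻ φs ps

  ⋀-toList⁺ : ∀ {k d} (v : Vec (Formula V k) d) {e} → (∀ j → M ⊨ lookup v j [ e ]) → M ⊨ ⋀ (toList v) [ e ]
  ⋀-toList⁺ []      _ = tt
  ⋀-toList⁺ (_ ∷ v) h = h zero , ⋀-toList⁺ v (h ∘ suc)

  ⋀-toList⁻ : ∀ {k d} (v : Vec (Formula V k) d) {e} → M ⊨ ⋀ (toList v) [ e ] → ∀ j → M ⊨ lookup v j [ e ]
  ⋀-toList⁻ (_ ∷ v) (p , _)  zero    = p
  ⋀-toList⁻ (_ ∷ v) (_ , ps) (suc j) = ⋀-toList⁻ v ps j

  ∀-closure⁺ : ∀ k {φ : Formula V k} → (∀ e → M ⊨ φ [ e ]) → M ⊨ ∀-closure k φ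
  ∀-closure⁺ zero    h = h []
  ∀-closure⁺ (suc k) h = ∀-closure⁺ k λ e x → h (x ∷ e)

  ∃*⁺ : ∀ {k} m {φ : Formula V (m + k)} {e} (z : Vec (Fin n) m) → M ⊨ φ [ z ++ⱽ e ] → M ⊨ ∃* m φ [ e ]
  ∃*⁺ zero    []      h = h
  ∃*⁺ (suc m) (x ∷ z) h = ∃*⁺ m z (x , h)

  ∃*⁻ : ∀ {k} m {φ : Formula V (m + k)} {e} → M ⊨ ∃* m φ [ e ] → ∃[ z ] M ⊨ φ [ z ++ⱽ e ]
  ∃*⁻ zero    h = [] , h
  ∃*⁻ (suc m) h with z , x , h′ ← ∃*⁻ m h = x ∷ z , h′

∈-symbols : ∀ {V m} (R : m ∈ V) → (m , R) ∈ symbols V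
∈-symbols (here refl) = here refl
∈-symbols (there R)   = there (∈-map⁺ (λ (k , R) → k , there R) (∈-symbols R))

∈-pairs : ∀ {d} (i j : Fin d) → i Fin.< j →
  (i , j) ∈ filter (λ (i , j) → i <? j) (cartesianProduct (List.allFin d) (List.allFin d))
∈-pairs i j i<j = ∈-filter⁺ (λ (i , j) → i <? j) (∈-cartesianProduct⁺ (∈-allFin i) (∈-allFin j)) i<j

-- The local function of χ, found by unification.
mutual
  literal : ∀ V d k (D : Structure V d) (x : Vec (Fin k) d) m → m ∈ V → Vec (Fin d) m → Formula V k
  literal = _

  χ-unfold : ∀ {V d k} (D : Structure V d) (x : Vec (Fin k) d) → χ D x ≡
    ⋀ (List.map (λ (i , j) → ¬ᶠ (lookup x i ≐ lookup x j))
        (filter (λ (i , j) → i <? j) (cartesianProduct (List.allFin d) (List.allFin d)))) ∧ᶠ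
    ⋀ (List.concatMap (λ (m , R) → List.map (literal V d k D x m R) (vecs (List.allFin d) m)) (symbols V))
  χ-unfold D x = refl

Embeds : ∀ {V n d} → Structure V n → Structure V d → Vec (Fin n) d → Set
Embeds {V} M D w = InjectiveVec w × (∀ {m} (R : m ∈ V) a → bit M R (Vec.map (lookup w) a) ≡ bit D R a)

module _ {V : Vocabulary} {n d k : ℕ} (M : Structure V n) (D : Structure V d) (x : Vec (Fin k) d) (e : Vec (Fin n) k) where
  private
    w : Vec (Fin n) d
    w = Vec.map (lookup e) x

    literals : (∃[ m ] m ∈ V) → List (Formula V k)
    literals (m , R) = List.map (literal V d k D x m R) (vecs (List.allFin d) m)

    distinctness diagram : List (Formula V k)
    distinctness = List.map (λ (i , j) → ¬ᶠ (lookup x i ≐ lookup x j))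
      (filter (λ (i , j) → i <? j) (cartesianProduct (List.allFin d) (List.allFin d)))
    diagram = List.concatMap literals (symbols V)

    map-w : ∀ {m} (a : Vec (Fin d) m) → Vec.map (lookup e) (Vec.map (lookup x) a) ≡ Vec.map (lookup w) a
    map-w a = trans (sym (map-∘ (lookup e) (lookup x) a)) (map-cong (λ i → sym (lookup-mapⱽ i (lookup e) x)) a)

    literal⁺ : ∀ {m} (R : m ∈ V) a → bit M R (Vec.map (lookup w) a) ≡ bit D R a → M ⊨ literal V d k D x m R a [ e ]
    literal⁺ R a eq with holds? D R a
    ... | yes h = subst T (trans (sym eq) (cong (bit M R) (sym (map-w a)))) h
    ... | no ¬h = λ h → ¬h (subst T (trans (cong (bit M R) (map-w a)) eq) h)

    literal⁻ : ∀ {m} (R : m ∈ V) a → M ⊨ literal V d k D x m R a [ e ] → bit M R (Vec.map (lookup w) a) ≡ bit D R a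
    literal⁻ R a lit with holds? D R a
    ... | yes h = T-ext (λ _ → h) (λ _ → subst T (cong (bit M R) (map-w a)) lit)
    ... | no ¬h = T-ext (λ h → contradiction (subst T (cong (bit M R) (sym (map-w a))) h) lit) (λ h → contradiction h ¬h)

  χ⁺ : Embeds M D w → M ⊨ χ D x [ e ]
  χ⁺ (w-inj , bits) =
    ⋀⁺ M distinctness (All.map⁺ (All.tabulate λ { {i , j} ij∈ eq → Fin.<⇒≢ (proj₂ (∈-filter⁻ (λ (i , j) → i <? j)
      {xs = cartesianProduct (List.allFin d) (List.allFin d)} ij∈))
      (w-inj i j (trans (lookup-mapⱽ i (lookup e) x) (trans eq (sym (lookup-mapⱽ j (lookup e) x))))) })) ,
    ⋀⁺ M diagram (All.concat⁺ {xss = List.map literals (symbols V)}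
      (All.map⁺ (All.tabulate λ { {m , R} _ → All.map⁺ (All.tabulate λ {a} _ → literal⁺ R a (bits R a)) })))

  χ⁻ : M ⊨ χ D x [ e ] → Embeds M D w
  χ⁻ (apart , lits) = w-inj , λ R a → literal⁻ R a
    (All.lookup (All.map⁻ (All.lookup
      (All.map⁻ (All.concat⁻ {xss = List.map literals (symbols V)} (⋀⁻ M diagram lits))) (∈-symbols R)))
      (∈-vecs ∈-allFin a))
    where
    separate : ∀ i j → i Fin.< j → lookup w i ≢ lookup w j
    separate i j i<j eq = All.lookup (All.map⁻ (⋀⁻ M distinctness apart)) (∈-pairs i j i<j)
      (trans (sym (lookup-mapⱽ i (lookup e) x)) (trans eq (lookup-mapⱽ j (lookup e) x)))
    w-inj : InjectiveVec w
    w-inj i j eq with Fin.<-cmp i j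
    ... | tri< i<j _ _ = contradiction eq (separate i j i<j)
    ... | tri≈ _ i≡j _ = i≡j
    ... | tri> _ _ j<i = contradiction (sym eq) (separate j i j<i)

-- What `ξ` says about elements, free of variable shifts.
Linked : ∀ {l V n} → ColourGadgets l V → Structure V n → Fin n → Fin n → Set
Linked G M a b = a ≡ b ⊎ ∃[ z ] Embeds M (ColourGadgets.𝒮 G) (z ++ⱽ a ∷ b ∷ [])

data Split {m n : ℕ} : Fin (m + n) → Set where
  left  : (i : Fin m) → Split (i ↑ˡ n)
  right : (j : Fin n) → Split (m ↑ʳ j)

split : ∀ m {n} (i : Fin (m + n)) → Split {m} {n} i
split zero    i       = right i
split (suc m) zero    = left zero
split (suc m) (suc i) with split m i
... | left i  = left (suc i)
... | right j = right j

↑ˡ≢↑ʳ : ∀ {m n} (i : Fin m) (j : Fin n) → i ↑ˡ n ≢ m ↑ʳ j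
↑ˡ≢↑ʳ {suc m} (suc i) j eq = ↑ˡ≢↑ʳ i j (Fin.suc-injective eq)

module _ {l : ℕ} {V : Vocabulary} (G : ColourGadgets l V) {n : ℕ} (M : Structure V n) where
  open ColourGadgets G

  private
    endpoints : ∀ {k} (e : Vec (Fin n) k) (z : Vec (Fin n) r) y₁ y₂ →
      Vec.map (lookup (z ++ⱽ e)) (Vec.map (_↑ˡ k) (Vec.allFin r) ++ⱽ (r ↑ʳ y₁) ∷ (r ↑ʳ y₂) ∷ []) ≡
      z ++ⱽ lookup e y₁ ∷ lookup e y₂ ∷ []
    endpoints {k} e z y₁ y₂ = lookup-ext λ i → trans (lookup-mapⱽ i (lookup (z ++ⱽ e)) vars) (agree i (split r i))
      where
      vars : Vec (Fin (r + k)) (r + 2)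
      vars = Vec.map (_↑ˡ k) (Vec.allFin r) ++ⱽ (r ↑ʳ y₁) ∷ (r ↑ʳ y₂) ∷ []
      agree : ∀ i → Split {r} i → lookup (z ++ⱽ e) (lookup vars i) ≡ lookup (z ++ⱽ lookup e y₁ ∷ lookup e y₂ ∷ []) i
      agree _ (left i) = begin
        lookup (z ++ⱽ e) (lookup vars (i ↑ˡ 2))
          ≡⟨ cong (lookup (z ++ⱽ e)) (lookup-++ˡ (Vec.map (_↑ˡ k) (Vec.allFin r)) _ i) ⟩
        lookup (z ++ⱽ e) (lookup (Vec.map (_↑ˡ k) (Vec.allFin r)) i)
          ≡⟨ cong (lookup (z ++ⱽ e)) (trans (lookup-mapⱽ i (_↑ˡ k) (Vec.allFin r)) (cong (_↑ˡ k) (lookup-allFin i))) ⟩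
        lookup (z ++ⱽ e) (i ↑ˡ k)                                       ≡⟨ lookup-++ˡ z e i ⟩
        lookup z i                                                      ≡⟨ lookup-++ˡ z _ i ⟨
        lookup (z ++ⱽ lookup e y₁ ∷ lookup e y₂ ∷ []) (i ↑ˡ 2)          ∎
        where open ≡-Reasoning
      agree _ (right j) = begin
        lookup (z ++ⱽ e) (lookup vars (r ↑ʳ j))
          ≡⟨ cong (lookup (z ++ⱽ e)) (lookup-++ʳ (Vec.map (_↑ˡ k) (Vec.allFin r)) _ j) ⟩
        lookup (z ++ⱽ e) (lookup ((r ↑ʳ y₁) ∷ (r ↑ʳ y₂) ∷ []) j)        ≡⟨ ends j ⟩
        lookup (lookup e y₁ ∷ lookup e y₂ ∷ []) j                       ≡⟨ lookup-++ʳ z _ j ⟨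
        lookup (z ++ⱽ lookup e y₁ ∷ lookup e y₂ ∷ []) (r ↑ʳ j)          ∎
        where
        open ≡-Reasoning
        ends : ∀ j → lookup (z ++ⱽ e) (lookup ((r ↑ʳ y₁) ∷ (r ↑ʳ y₂) ∷ []) j) ≡ lookup (lookup e y₁ ∷ lookup e y₂ ∷ []) j
        ends zero       = lookup-++ʳ z e y₁
        ends (suc zero) = lookup-++ʳ z e y₂

  ξ⁺ : ∀ {k} {e : Vec (Fin n) k} y₁ y₂ → Linked G M (lookup e y₁) (lookup e y₂) → M ⊨ ξ G y₁ y₂ [ e ]
  ξ⁺ y₁ y₂ (inj₁ eq)          = inj₁ eq
  ξ⁺ {e = e} y₁ y₂ (inj₂ (z , emb)) = inj₂ (∃*⁺ M r z (χ⁺ M 𝒮 _ (z ++ⱽ e) (subst (Embeds M 𝒮) (sym (endpoints e z y₁ y₂)) emb)))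

  ξ⁻ : ∀ {k} {e : Vec (Fin n) k} y₁ y₂ → M ⊨ ξ G y₁ y₂ [ e ] → Linked G M (lookup e y₁) (lookup e y₂)
  ξ⁻ y₁ y₂ (inj₁ eq) = inj₁ eq
  ξ⁻ {e = e} y₁ y₂ (inj₂ h) with z , h′ ← ∃*⁻ M r h =
    inj₂ (z , subst (Embeds M 𝒮) (endpoints e z y₁ y₂) (χ⁻ M 𝒮 _ (z ++ⱽ e) h′))

  module _ {k d} (γ : Vec (Fin l) d) (τ : Vec (Fin l) l) (x : Vec (Fin k) l) (y : Vec (Fin k) d) {e : Vec (Fin n) k} where
    private
      link : Fin l → Fin k → Formula V k
      link c yⱼ = ξ G (lookup x (lookup τ c)) yⱼ

    θ⁺ : (∀ j → Linked G M (lookup e (lookup x (lookup τ (lookup γ j)))) (lookup e (lookup y j))) → M ⊨ θ G γ τ x y [ e ]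
    θ⁺ h = ⋀-toList⁺ M (Vec.zipWith link γ y) λ j →
      subst (λ φ → M ⊨ φ [ e ]) (sym (lookup-zipWith link j γ y)) (ξ⁺ _ _ (h j))

    θ⁻ : M ⊨ θ G γ τ x y [ e ] → ∀ j → Linked G M (lookup e (lookup x (lookup τ (lookup γ j)))) (lookup e (lookup y j))
    θ⁻ h j = ξ⁻ _ _ (subst (λ φ → M ⊨ φ [ e ]) (lookup-zipWith link j γ y) (⋀-toList⁻ M (Vec.zipWith link γ y) h j))

  -- A colouring of `M` pulls back along the embedding to a colouring of `𝒮`, to which `𝒮-same`
  -- applies.
  linked⇒sameColour : ∀ {γ : Vec (Fin l) n} → IsColouring M γ → ∀ {a b} → Linked G M a b → lookup γ a ≡ lookup γ b
  linked⇒sameColour isCol (inj₁ refl) = refl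
  linked⇒sameColour {γ} isCol {a} {b} (inj₂ (z , _ , bits)) = begin
    lookup γ a                                     ≡⟨ cong (lookup γ) (lookup-++ʳ z (a ∷ b ∷ []) zero) ⟨
    lookup γ (lookup w (r ↑ʳ zero))                ≡⟨ lookup-mapⱽ (r ↑ʳ zero) (lookup γ) w ⟨
    lookup (Vec.map (lookup γ) w) (r ↑ʳ zero)      ≡⟨ 𝒮-same (Vec.map (lookup γ) w) pulled ⟩
    lookup (Vec.map (lookup γ) w) (r ↑ʳ suc zero)  ≡⟨ lookup-mapⱽ (r ↑ʳ suc zero) (lookup γ) w ⟩
    lookup γ (lookup w (r ↑ʳ suc zero))            ≡⟨ cong (lookup γ) (lookup-++ʳ z (a ∷ b ∷ []) (suc zero)) ⟩
    lookup γ b                                     ∎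
    where
    open ≡-Reasoning
    w = z ++ⱽ a ∷ b ∷ []
    pulled : IsColouring 𝒮 (Vec.map (lookup γ) w)
    pulled R t holds mono = isCol R (Vec.map (lookup w) t) (subst T (sym (bits R t)) holds) λ p q →
      trans (sym (colour≡ p)) (trans (mono p q) (colour≡ q))
      where
      colour≡ : ∀ p → lookup (Vec.map (lookup γ) w) (lookup t p) ≡ lookup γ (lookup (Vec.map (lookup w) t) p)
      colour≡ p = trans (lookup-mapⱽ (lookup t p) (lookup γ) w) (cong (lookup γ) (sym (lookup-mapⱽ p (lookup w) t)))

module _ {l V n d} (ω : Ω l V n) (D : Structure V d) {γ′ : Vec (Fin l) d} (γ′-col : IsColouring D γ′) {w : Vec (Fin n) d}
         (colours : ∀ i → lookup (proj₁ ω) (lookup w i) ≡ lookup γ′ i) where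

  private
    colour≡ : ∀ {m} (a : Vec (Fin d) m) p → lookup (proj₁ ω) (lookup (Vec.map (lookup w) a) p) ≡ lookup γ′ (lookup a p)
    colour≡ a p = trans (cong (lookup (proj₁ ω)) (lookup-mapⱽ p (lookup w) a)) (colours (lookup a p))

  -- Both bits are false: `proper` has removed the image tuple, and the colouring `γ′` forbids the
  -- tuple in `D`.
  mono-agree : ∀ {m} (R : m ∈ V) a → Mono γ′ a → bit (proper ω) R (Vec.map (lookup w) a) ≡ bit D R a
  mono-agree R a mono = trans
    (bit-mono (proj₁ ω) (proj₂ ω) R (Vec.map (lookup w) a) λ p q → trans (colour≡ a p) (trans (mono p q) (sym (colour≡ a q))))
    (T-ext (λ ()) λ h → γ′-col R a h mono)

  -- A tuple touching a new point is either covered by `mono-agree`, or not monochromatic, in which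
  -- case `proper` keeps the bit prescribed by `Good`. Old tuples are left to the caller.
  good⇒embeds : {New : Pred (Fin d) 0ℓ} (New? : Decidable New) (let open Extension l V D New?) →
    Good γ′ w ω → InjectiveVec w →
    (∀ {m} (R : m ∈ V) a → ¬ Touches a → bit (proper ω) R (Vec.map (lookup w) a) ≡ bit D R a) →
    Embeds (proper ω) D w
  good⇒embeds New? (_ , bits) w-inj old = w-inj , agree
    where
    open Extension l V D New?
    agree : ∀ {m} (R : m ∈ V) a → bit (proper ω) R (Vec.map (lookup w) a) ≡ bit D R a
    agree R a with touches? a | mono? γ′ a
    ... | no ¬touches | _        = old R a ¬touches
    ... | yes _       | yes mono = mono-agree R a mono
    ... | yes touches | no ¬mono = trans
      (bit-¬mono (proj₁ ω) (proj₂ ω) R (Vec.map (lookup w) a) λ mono →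
        ¬mono λ p q → trans (sym (colour≡ a p)) (trans (mono p q) (colour≡ a q)))
      (bits R a touches)

-- Rich outcomes satisfy the extension axioms

module _ {l V} (G : ColourGadgets l V) where
  open ColourGadgets G

  Inner : Pred (Fin (r + 2)) 0ℓ
  Inner i = ∃[ j ] j ↑ˡ 2 ≡ i

  inner? : Decidable Inner
  inner? i = any? λ j → (j ↑ˡ 2) ≟ᶠ i

  module 𝒮-extension = Extension l V 𝒮 inner?

  -- Richness supplies the inner points of `𝒮`. Old tuples involve only the two endpoints, which
  -- `γ′` colours alike, so they are monochromatic and agree automatically.
  sameColour⇒linked : ∀ {n} (ω : Ω l V n) → 𝒮-extension.Rich ω →
    ∀ {a b} → lookup (proj₁ ω) a ≡ lookup (proj₁ ω) b → Linked G (proper ω) a b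
  sameColour⇒linked {n} ω rich {a} {b} γa≡γb with a ≟ᶠ b
  ... | yes a≡b = inj₁ a≡b
  ... | no a≢b = inj₂ (z , subst (Embeds (proper ω) 𝒮) w≡ (good⇒embeds ω 𝒮 {γ′} γ′-col {w} colours inner? good w-inj
                   λ R t ¬touches → mono-agree ω 𝒮 {γ′} γ′-col {w} colours R t
                     λ p q → trans (outerColour t ¬touches p) (sym (outerColour t ¬touches q))))
    where
    open 𝒮-extension
    γ = proj₁ ω
    γ′ : Vec (Fin l) (r + 2)
    γ′ = proj₁ (𝒮-every (lookup γ a))
    γ′-col : IsColouring 𝒮 γ′
    γ′-col = proj₁ (proj₂ (𝒮-every (lookup γ a)))
    ends : ∀ k → lookup γ′ (r ↑ʳ k) ≡ lookup γ a
    ends zero       = proj₁ (proj₂ (proj₂ (𝒮-every (lookup γ a))))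
    ends (suc zero) = proj₂ (proj₂ (proj₂ (𝒮-every (lookup γ a))))
    y : Vec (Fin n) (r + 2)
    -- The first `r` entries are placeholders: `InjectiveOld` and `Extends` ignore new indices.
    y = Vec.replicate r a ++ⱽ a ∷ b ∷ []
    y-end : ∀ k → lookup y (r ↑ʳ k) ≡ lookup (a ∷ b ∷ []) k
    y-end = lookup-++ʳ (Vec.replicate r a) (a ∷ b ∷ [])
    y-inj : InjectiveOld y
    y-inj i j ¬i ¬j eq with split r i | split r j
    ... | left i  | _       = contradiction (i , refl) ¬i
    ... | right _ | left j  = contradiction (j , refl) ¬j
    ... | right i | right j = cong (r ↑ʳ_) (pair i j (trans (sym (y-end i)) (trans eq (y-end j))))
      where
      pair : ∀ i j → lookup (a ∷ b ∷ []) i ≡ lookup (a ∷ b ∷ []) j → i ≡ j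
      pair zero       zero       _  = refl
      pair zero       (suc zero) eq = contradiction eq a≢b
      pair (suc zero) zero       eq = contradiction (sym eq) a≢b
      pair (suc zero) (suc zero) _  = refl
    extension′ : Extendable γ′ y ω
    extension′ = rich γ′ y y-inj
    w : Vec (Fin n) (r + 2)
    w = proj₁ extension′
    w-inj : InjectiveVec w
    w-inj = proj₁ (proj₂ (proj₂ extension′))
    good : Good γ′ w ω
    good = proj₂ (proj₂ (proj₂ extension′))
    z : Vec (Fin n) r
    z = tabulate λ j → lookup w (j ↑ˡ 2)
    w-end : ∀ k → lookup w (r ↑ʳ k) ≡ lookup (a ∷ b ∷ []) k
    w-end k = trans (proj₁ (proj₂ extension′) (r ↑ʳ k) λ (j , eq) → ↑ˡ≢↑ʳ j k eq) (y-end k)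
    w≡ : w ≡ z ++ⱽ a ∷ b ∷ []
    w≡ = lookup-ext λ i → agree (split r i)
      where
      agree : ∀ {i} → Split {r} i → lookup w i ≡ lookup (z ++ⱽ a ∷ b ∷ []) i
      agree (left j)  = sym (trans (lookup-++ˡ z (a ∷ b ∷ []) j) (lookup∘tabulate _ j))
      agree (right k) = trans (w-end k) (sym (lookup-++ʳ z (a ∷ b ∷ []) k))
    colours : ∀ i → lookup γ (lookup w i) ≡ lookup γ′ i
    colours i with split r i
    ... | left j  = proj₁ good (j ↑ˡ 2) (j , refl)
    ... | right k = trans (cong (lookup γ) (w-end k)) (trans (endColour k) (sym (ends k)))
      where
      endColour : ∀ k → lookup γ (lookup (a ∷ b ∷ []) k) ≡ lookup γ a
      endColour zero       = refl
      endColour (suc zero) = sym γa≡γb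
    outerColour : ∀ {m} (t : Vec (Fin (r + 2)) m) → ¬ Touches t → ∀ p → lookup γ′ (lookup t p) ≡ lookup γ a
    outerColour t ¬touches p = outer (lookup t p) λ inner → ¬touches (p , inner)
      where
      outer : ∀ i → ¬ Inner i → lookup γ′ i ≡ lookup γ a
      outer i ¬inner with split r i
      ... | left j  = contradiction (j , refl) ¬inner
      ... | right k = ends k

module _ {l V} (G : ColourGadgets l V) {α k : ℕ} (𝒜 : Structure V α) (𝓑 : Structure V (α + k))
         (sub : IsSubstructure 𝒜 𝓑) where
  open ColourGadgets G

  Added : Pred (Fin (α + k)) 0ℓ
  Added i = ∃[ j ] α ↑ʳ j ≡ i

  added? : Decidable Added
  added? i = any? λ j → (α ↑ʳ j) ≟ᶠ i

  module 𝓑-extension = Extension l V 𝓑 added?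

  private
    lookup-take : ∀ {A : Set} m {n} (v : Vec A (m + n)) (i : Fin m) → lookup (Vec.take m v) i ≡ lookup v (i ↑ˡ n)
    lookup-take m v i = trans (sym (lookup-++ˡ (Vec.take m v) (Vec.drop m v) i)) (cong (λ u → lookup u (i ↑ˡ _)) (take++drop≡id m v))

  module _ {n} (ω : Ω l V n) (𝒮-rich : 𝒮-extension.Rich G ω) (𝓑-rich : 𝓑-extension.Rich ω) (x₀ : Fin n)
           {γ′ : Vec (Fin l) (α + k)} (γ′-col : IsColouring 𝓑 γ′)
           {τ : Vec (Fin l) l} (τ-inj : ∀ i j → lookup τ i ≡ lookup τ j → i ≡ j) where
    open 𝓑-extension

    private
      M = proper ω
      γ = proj₁ ω

      -- This and the next definitions repeat those local to `instanceOf`, so that its matrix is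
      -- `hypothesis ⇒ᶠ conclusion` by computation.
      x : Vec (Fin (k + (u + α))) u
      x = tabulate λ i → k ↑ʳ (i ↑ˡ α)

      x₁…x_l : Vec (Fin (k + (u + α))) l
      x₁…x_l = tabulate λ i → lookup x (inject≤ i l≤u)

      y : Vec (Fin (k + (u + α))) α
      y = tabulate λ j → k ↑ʳ (u ↑ʳ j)

      y′ : Vec (Fin (k + (u + α))) (α + k)
      y′ = y ++ⱽ tabulate λ j → j ↑ˡ (u + α)

      hypothesis conclusion : Formula V (k + (u + α))
      hypothesis = ζ G x ∧ᶠ χ 𝒜 y ∧ᶠ θ G (Vec.take α γ′) τ x₁…x_l y
      conclusion = χ 𝓑 y′ ∧ᶠ θ G γ′ τ x₁…x_l y′

    module _ (e : Vec (Fin n) (u + α)) where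
      private
        X : Fin l → Fin n
        X c = lookup e (inject≤ c l≤u ↑ˡ α)

        Y : Fin α → Fin n
        Y j = lookup e (u ↑ʳ j)

        x-value : ∀ (z : Vec (Fin n) k) i → lookup (z ++ⱽ e) (lookup x i) ≡ lookup e (i ↑ˡ α)
        x-value z i = trans (cong (lookup (z ++ⱽ e)) (lookup∘tabulate _ i)) (lookup-++ʳ z e (i ↑ˡ α))

        X-value : ∀ (z : Vec (Fin n) k) c → lookup (z ++ⱽ e) (lookup x₁…x_l c) ≡ X c
        X-value z c = trans (cong (lookup (z ++ⱽ e)) (lookup∘tabulate _ c)) (x-value z (inject≤ c l≤u))

        Y-value : ∀ (z : Vec (Fin n) k) j → lookup (z ++ⱽ e) (lookup y j) ≡ Y j
        Y-value z j = trans (cong (lookup (z ++ⱽ e)) (lookup∘tabulate _ j)) (lookup-++ʳ z e (u ↑ʳ j))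

      -- By `ζ` the elements `X` have different colours, so `π` is injective and `γ″` is again a
      -- colouring of `𝓑`. It agrees with the actual colours on the old elements, and `𝓑`-richness
      -- is applied to it. The new links then come from equality of colours.
      extend : ∀ (z₀ : Vec (Fin n) k) → M ⊨ hypothesis [ z₀ ++ⱽ e ] → ∃[ z ] M ⊨ conclusion [ z ++ⱽ e ]
      extend z₀ ((_ , _ , hζ) , h𝒜 , hθ) = z ,
        χ⁺ M 𝓑 y′ (z ++ⱽ e) (subst (Embeds M 𝓑) (sym y′≡w) embeds) ,
        θ⁺ G M γ′ τ x₁…x_l y′ λ j → subst₂ (Linked G M) (sym (X-value z _)) (sym (y′-value j))
          (sameColour⇒linked G ω 𝒮-rich (trans (sym (lookup-mapⱽ j π γ′)) (sym (colours j))))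
        where
        -- The elements x₁,…,x_l have pairwise different colours, since κ separates them.
        apart : ∀ i j → i Fin.< j → lookup κ i ≢ lookup κ j →
          lookup γ (lookup e (i ↑ˡ α)) ≢ lookup γ (lookup e (j ↑ˡ α))
        apart i j i<j κ≢ γ≡ = All.lookup (All.map⁻ (⋀⁻ M _ hζ)) (∈-filter⁺ _ (∈-pairs i j i<j) κ≢)
          (ξ⁺ G M _ _ (subst₂ (Linked G M) (sym (x-value z₀ i)) (sym (x-value z₀ j)) (sameColour⇒linked G ω 𝒮-rich γ≡)))

        X-colours : ∀ c c′ → lookup γ (X c) ≡ lookup γ (X c′) → c ≡ c′
        -- `ζ` lists only pairs i < j, so the indices are ordered first. Equal values of `κ` give
        -- `c ≡ c′` by `κ-distinct`; different ones contradict `apart`.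
        X-colours c c′ γ≡ with Fin.<-cmp (inject≤ c l≤u) (inject≤ c′ l≤u)
        ... | tri≈ _ eq _ = inject≤-injective l≤u l≤u c c′ eq
        ... | tri< c<c′ _ _ = separated (lookup κ (inject≤ c l≤u) ≟ᶠ lookup κ (inject≤ c′ l≤u))
          where
          separated : Dec (lookup κ (inject≤ c l≤u) ≡ lookup κ (inject≤ c′ l≤u)) → c ≡ c′
          separated (yes κ≡) = κ-distinct c c′ κ≡
          separated (no κ≢)  = contradiction γ≡ (apart _ _ c<c′ κ≢)
        ... | tri> _ _ c′<c = separated (lookup κ (inject≤ c′ l≤u) ≟ᶠ lookup κ (inject≤ c l≤u))
          where
          separated : Dec (lookup κ (inject≤ c′ l≤u) ≡ lookup κ (inject≤ c l≤u)) → c ≡ c′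
          separated (yes κ≡) = sym (κ-distinct c′ c κ≡)
          separated (no κ≢)  = contradiction (sym γ≡) (apart _ _ c′<c κ≢)

        -- The colour in the outcome of the element that represents the abstract colour `c`.
        π : Fin l → Fin l
        π c = lookup γ (X (lookup τ c))

        π-inj : ∀ {c c′} → π c ≡ π c′ → c ≡ c′
        π-inj eq = τ-inj _ _ (X-colours _ _ eq)

        γ″ : Vec (Fin l) (α + k)
        γ″ = Vec.map π γ′

        γ″-col : IsColouring 𝓑 γ″
        γ″-col R a holds mono = γ′-col R a holds λ p q →
          π-inj (trans (sym (lookup-mapⱽ (lookup a p) π γ′)) (trans (mono p q) (lookup-mapⱽ (lookup a q) π γ′)))

        ys : Vec (Fin n) α
        ys = tabulate Y

        ys-embeds : Embeds M 𝒜 ys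
        ys-embeds = subst (Embeds M 𝒜) {Vec.map (lookup (z₀ ++ⱽ e)) y} {ys} (lookup-ext λ j → trans (lookup-mapⱽ j (lookup (z₀ ++ⱽ e)) y)
          (trans (Y-value z₀ j) (sym (lookup∘tabulate Y j)))) (χ⁻ M 𝒜 y (z₀ ++ⱽ e) h𝒜)

        -- `θ` in the hypothesis links each old element to the representative of its abstract
        -- colour.
        Y-colour : ∀ j → lookup γ (Y j) ≡ π (lookup γ′ (j ↑ˡ k))
        Y-colour j = begin
          lookup γ (Y j)                                     ≡⟨ cong (lookup γ) (Y-value z₀ j) ⟨
          lookup γ (lookup (z₀ ++ⱽ e) (lookup y j))          ≡⟨ linked⇒sameColour G M {γ} (proper-colouring γ (proj₂ ω))
                                                                  (θ⁻ G M (Vec.take α γ′) τ x₁…x_l y hθ j) ⟨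
          lookup γ (lookup (z₀ ++ⱽ e) (lookup x₁…x_l (lookup τ (lookup (Vec.take α γ′) j))))
                                                             ≡⟨ cong (lookup γ) (X-value z₀ _) ⟩
          π (lookup (Vec.take α γ′) j)                       ≡⟨ cong π (lookup-take α γ′ j) ⟩
          π (lookup γ′ (j ↑ˡ k))                             ∎
          where open ≡-Reasoning

        yv : Vec (Fin n) (α + k)
        -- `x₀` fills the new positions, which richness ignores.
        yv = ys ++ⱽ Vec.replicate k x₀

        yv-inj : InjectiveOld yv
        yv-inj i j ¬i ¬j eq with split α i | split α j
        ... | right i | _       = contradiction (i , refl) ¬i
        ... | left _  | right j = contradiction (j , refl) ¬j
        ... | left i  | left j  = cong (_↑ˡ k) (proj₁ ys-embeds i j
          (trans (sym (lookup-++ˡ ys _ i)) (trans eq (lookup-++ˡ ys _ j))))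

        extension′ : Extendable γ″ yv ω
        extension′ = 𝓑-rich γ″ yv yv-inj

        w : Vec (Fin n) (α + k)
        w = proj₁ extension′

        w-inj : InjectiveVec w
        w-inj = proj₁ (proj₂ (proj₂ extension′))

        good : Good γ″ w ω
        good = proj₂ (proj₂ (proj₂ extension′))

        w-old : ∀ j → lookup w (j ↑ˡ k) ≡ Y j
        w-old j = trans (proj₁ (proj₂ extension′) (j ↑ˡ k) λ (i , eq) → ↑ˡ≢↑ʳ j i (sym eq))
          (trans (lookup-++ˡ ys _ j) (lookup∘tabulate Y j))

        z : Vec (Fin n) k
        z = tabulate λ j → lookup w (α ↑ʳ j)

        colours : ∀ i → lookup γ (lookup w i) ≡ lookup γ″ i
        colours i with split α i
        ... | right j = proj₁ good (α ↑ʳ j) (j , refl)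
        ... | left j  = trans (cong (lookup γ) (w-old j)) (trans (Y-colour j) (sym (lookup-mapⱽ (j ↑ˡ k) π γ′)))

        -- A tuple without added points lies in `𝒜`, which `ys` embeds and which is a substructure
        -- of `𝓑`.
        old-agree : ∀ {m} (R : m ∈ V) (a : Vec (Fin (α + k)) m) → ¬ Touches a → bit M R (Vec.map (lookup w) a) ≡ bit 𝓑 R a
        old-agree R a ¬touches = begin
          bit M R (Vec.map (lookup w) a)                     ≡⟨ cong (λ a → bit M R (Vec.map (lookup w) a)) a≡ ⟩
          bit M R (Vec.map (lookup w) (Vec.map (_↑ˡ k) a₀))  ≡⟨ cong (bit M R) (map-∘ (lookup w) (_↑ˡ k) a₀) ⟨
          bit M R (Vec.map (lookup w ∘ (_↑ˡ k)) a₀)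
            ≡⟨ cong (bit M R) (map-cong (λ j → trans (w-old j) (sym (lookup∘tabulate Y j))) a₀) ⟩
          bit M R (Vec.map (lookup ys) a₀)                   ≡⟨ proj₂ ys-embeds R a₀ ⟩
          bit 𝒜 R a₀
            ≡⟨ T-ext (Equivalence.to (sub R a₀)) (Equivalence.from (sub R a₀)) ⟩
          bit 𝓑 R (Vec.map (_↑ˡ k) a₀)                       ≡⟨ cong (bit 𝓑 R) a≡ ⟨
          bit 𝓑 R a                                          ∎
          where
          open ≡-Reasoning
          old : ∀ i → ¬ Added i → ∃[ j ] i ≡ j ↑ˡ k
          old i ¬added with split α i
          ... | left j  = j , refl
          ... | right j = contradiction (j , refl) ¬added
          a₀ : Vec (Fin α) _
          a₀ = tabulate λ p → proj₁ (old (lookup a p) λ added → ¬touches (p , added))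
          a≡ : a ≡ Vec.map (_↑ˡ k) a₀
          a≡ = lookup-ext λ p → trans (proj₂ (old (lookup a p) λ added → ¬touches (p , added)))
            (sym (trans (lookup-mapⱽ p (_↑ˡ k) a₀) (cong (_↑ˡ k) (lookup∘tabulate _ p))))

        embeds : Embeds M 𝓑 w
        embeds = good⇒embeds ω 𝓑 {γ″} γ″-col {w} colours added? good w-inj old-agree

        y′-value : ∀ i → lookup (z ++ⱽ e) (lookup y′ i) ≡ lookup w i
        y′-value i with split α i
        ... | left j  = trans (cong (lookup (z ++ⱽ e)) (lookup-++ˡ y _ j)) (trans (Y-value z j) (sym (w-old j)))
        ... | right j = trans (cong (lookup (z ++ⱽ e)) (trans (lookup-++ʳ y _ j) (lookup∘tabulate _ j)))
          (trans (lookup-++ˡ z e j) (lookup∘tabulate _ j))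

        y′≡w : Vec.map (lookup (z ++ⱽ e)) y′ ≡ w
        y′≡w = lookup-ext λ i → trans (lookup-mapⱽ i (lookup (z ++ⱽ e)) y′) (y′-value i)

    -- The existential quantifiers enclose the implication, so witnesses are owed even if the
    -- hypothesis fails; copies of `x₀` then do. The hypothesis mentions none of the bound variables
    -- and may be decided at this default.
    rich⇒instance : M ⊨ instanceOf G 𝒜 𝓑 γ′ τ
    rich⇒instance = ∀-closure⁺ M (u + α) λ e → witness e (sat? M hypothesis (Vec.replicate k x₀ ++ⱽ e))
      where
      witness : ∀ e → Dec (M ⊨ hypothesis [ Vec.replicate k x₀ ++ⱽ e ]) → M ⊨ ∃* k (hypothesis ⇒ᶠ conclusion) [ e ]
      witness e (yes h) = ∃*⁺ M k (proj₁ (extend e (Vec.replicate k x₀) h)) λ _ → proj₂ (extend e (Vec.replicate k x₀) h)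
      witness e (no ¬h) = ∃*⁺ M k (Vec.replicate k x₀) λ h → contradiction h ¬h

  rich⇒axiom : ∀ {n} (ω : Ω l V n) → 𝒮-extension.Rich G ω → 𝓑-extension.Rich ω → Fin n → proper ω ⊨ extensionAxiom G 𝒜 𝓑
  rich⇒axiom ω 𝒮-rich 𝓑-rich x₀ = ⋀⁺ (proper ω) _ (All.tabulate λ φ∈ → holds φ∈)
    where
    holds : ∀ {φ} → φ ∈ List.cartesianProductWith (instanceOf G 𝒜 𝓑) (colourings l 𝓑) (permutations G) → proper ω ⊨ φ
    holds φ∈ with ∈-cartesianProductWith⁻ (instanceOf G 𝒜 𝓑) (colourings l 𝓑) (permutations G) φ∈
    ... | γ′ , τ , γ′∈ , τ∈ , refl = rich⇒instance ω 𝒮-rich 𝓑-rich x₀ {γ′}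
      (proj₂ (∈-filter⁻ (isColouring? 𝓑) {xs = vecs (List.allFin l) (α + k)} γ′∈)) {τ}
      (UniqueVec.lookup-injective (proj₂ (∈-filter⁻ _ {xs = vecs (List.allFin l) l} τ∈)))

-- From negligible failures to the limit

toℚᵘ-fraction : ∀ b t → ℚ.toℚᵘ (ι b ℚ.* (ℤ.+ 1 / suc t)) ℚᵘ.≃ ℚᵘ.mkℚᵘ (ℤ.+ b) t
toℚᵘ-fraction b t =
  ℚᵘ.≃-trans (ℚ.toℚᵘ-homo-* (ι b) (ℤ.+ 1 / suc t))
  (ℚᵘ.≃-trans (ℚᵘ.*-cong (toℚᵘ-ι b) (ℚ.toℚᵘ-fromℚᵘ (ℚᵘ.mkℚᵘ (ℤ.+ 1) t)))
  (ℚᵘ.*≡* (cong₂ ℤ._*_ (ℤ.*-identityʳ (ℤ.+ b)) (cong (λ m → ℤ.+ suc m) (sym (ℕ.+-identityʳ t))))))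

-- A positive rational is at least 1 over its denominator.
fraction-< : ∀ ε → 0ℚ ℚ.< ε → ∀ b t → ℚ.↧ₙ ε * b < suc t → ι b ℚ.* (ℤ.+ 1 / suc t) ℚ.< ε
fraction-< (mkℚ (ℤ.+ zero) _ _)    (ℚ.*<* (ℤ.+<+ ()))
fraction-< (mkℚ (ℤ.-[1+ _ ]) _ _)  (ℚ.*<* ())
fraction-< ε@(mkℚ (ℤ.+ suc p) d _) _ b t lt = ℚ.toℚᵘ-cancel-< (ℚᵘ.<-respˡ-≃ (ℚᵘ.≃-sym (toℚᵘ-fraction b t))
  (ℚᵘ.*<* (ℤ.≤-<-trans (ℤ.≤-reflexive (sym (ℤ.pos-* b (suc d)))) (ℤ.<-≤-trans (ℤ.+<+ b*d<) (ℤ.≤-reflexive (ℤ.pos-* (suc p) (suc t)))))))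
  where
  b*d< : b * suc d < suc p * suc t
  b*d< = ℕ.<-≤-trans (subst (_< suc t) (ℕ.*-comm (suc d) b) lt) (ℕ.m≤m+n (suc t) (p * suc t))

fraction-≥0 : ∀ b t → 0ℚ ℚ.≤ ι b ℚ.* (ℤ.+ 1 / suc t)
fraction-≥0 b t = ℚ.toℚᵘ-cancel-≤ (ℚᵘ.≤-respʳ-≃ (ℚᵘ.≃-sym (toℚᵘ-fraction b t))
  (ℚᵘ.*≤* (ℤ.≤-trans (ℤ.≤-reflexive (ℤ.*-zeroˡ (ℤ.+ suc t)))
    (ℤ.≤-trans (ℤ.+≤+ z≤n) (ℤ.≤-reflexive (sym (ℤ.*-identityʳ (ℤ.+ b))))))))

∣p-1∣≡q : ∀ {p q} → p ℚ.+ q ≡ 1ℚ → 0ℚ ℚ.≤ q → ℚ.∣ p ℚ.- 1ℚ ∣ ≡ q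
∣p-1∣≡q {p} {q} p+q≡1 0≤q = begin
  ℚ.∣ p ℚ.- 1ℚ ∣                    ≡⟨ cong (λ r → ℚ.∣ p ℚ.- r ∣) p+q≡1 ⟨
  ℚ.∣ p ℚ.- (p ℚ.+ q) ∣             ≡⟨ cong (λ r → ℚ.∣ p ℚ.+ r ∣) (ℚ.neg-distrib-+ p q) ⟩
  ℚ.∣ p ℚ.+ (ℚ.- p ℚ.+ ℚ.- q) ∣     ≡⟨ cong ℚ.∣_∣ (ℚ.+-assoc p (ℚ.- p) (ℚ.- q)) ⟨
  ℚ.∣ p ℚ.+ ℚ.- p ℚ.+ ℚ.- q ∣       ≡⟨ cong (λ r → ℚ.∣ r ℚ.+ ℚ.- q ∣) (ℚ.+-inverseʳ p) ⟩
  ℚ.∣ 0ℚ ℚ.+ ℚ.- q ∣                ≡⟨ cong ℚ.∣_∣ (ℚ.+-identityˡ (ℚ.- q)) ⟩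
  ℚ.∣ ℚ.- q ∣                       ≡⟨ ℚ.∣-p∣≡∣p∣ q ⟩
  ℚ.∣ q ∣                           ≡⟨ ℚ.0≤p⇒∣p∣≡p 0≤q ⟩
  q                                 ∎
  where open ≡-Reasoning

-- The denominator of `ε` is taken as the `Q` of `Negligible`.
negligible-complement : {f : ℕ → ℚ} {b T : ℕ → ℕ} → (∀ n → T n ≡ suc (ℕ.pred (T n))) →
  (∀ n → f n ℚ.+ ι (b n) ℚ.* (ℤ.+ 1 / suc (ℕ.pred (T n))) ≡ 1ℚ) → Negligible b T → f ⟶ 1ℚ
negligible-complement {f} {b} {T} T≡ complement b≪ ε 0<ε with N , small ← b≪ (ℚ.↧ₙ ε) = N , λ n N≤n →
  ℚ.≤-<-trans (ℚ.≤-reflexive (∣p-1∣≡q {f n} (complement n) (fraction-≥0 (b n) (ℕ.pred (T n)))))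
    (fraction-< ε 0<ε (b n) (ℕ.pred (T n)) (ℕ.<-≤-trans (small n N≤n) (ℕ.≤-reflexive (T≡ n))))

module _ (l : ℕ) (V : Vocabulary) (arities : All (2 ≤_) V) (c₀ : Fin l) where

  someOutcome : ∀ n → Ω l V n
  -- Any outcome would do; it shows that `size n` is positive.
  someOutcome n = Vec.replicate n c₀ , tabulateˢ λ _ _ → false

  private
    size : ℕ → ℕ
    size n = length (outcomes l V n)

    weight : ℕ → ℚ
    weight n = ℤ.+ 1 / suc (ℕ.pred (size n))

  size>0 : ∀ n → 0 < size n
  size>0 n = Measure.size>0 l V n arities (someOutcome n)

  reduct∈𝐂 : ∀ {n} (ω : Ω l V n) → reduct l V (mask ω) ∈ 𝐂 l V n
  reduct∈𝐂 {n} ω = ∈-deduplicate⁺ _≟ˢ_ (∈-map⁺ (reduct l V) (Measure.∈𝐊⁺ l V n arities (someOutcome n) ω))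

  module _ (φ : Sentence V) where

    Models : ∀ {n} → Pred (Structure (L l V) n) 0ℓ
    Models {n} M = reduct l V M ∈ 𝐂 l V n × reduct l V M ⊨ φ

    models? : ∀ {n} → Decidable (Models {n})
    models? {n} M = (reduct l V M ∈? 𝐂 l V n) ×-dec (reduct l V M ⊨? φ)

    successes failures : ℕ → ℕ
    successes n = # (models? ∘ mask) (outcomes l V n)
    failures n  = # (¬? ∘ models? ∘ mask) (outcomes l V n)

    δᶜ-uniform : ∀ n → δᶜ-sentence l V φ n ≡ ι (successes n) ℚ.* weight n
    δᶜ-uniform n = Measure.δᴷ-uniform l V n arities (someOutcome n) models?

    total : ∀ n → ι (successes n) ℚ.* weight n ℚ.+ ι (failures n) ℚ.* weight n ≡ 1ℚ
    total n = begin
      ι (successes n) ℚ.* weight n ℚ.+ ι (failures n) ℚ.* weight n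
        ≡⟨ ℚ.*-distribʳ-+ (weight n) (ι (successes n)) (ι (failures n)) ⟨
      (ι (successes n) ℚ.+ ι (failures n)) ℚ.* weight n
        ≡⟨ cong (ℚ._* weight n) (ι-+ (successes n) (failures n)) ⟨
      ι (successes n + failures n) ℚ.* weight n
        ≡⟨ cong (λ t → ι t ℚ.* weight n) (#-complement (models? ∘ mask) (outcomes l V n)) ⟩
      ι (size n) ℚ.* weight n
        ≡⟨ Measure.size*w l V n arities (someOutcome n) ⟩
      1ℚ ∎
      where open ≡-Reasoning

    negligible⇒limit : Negligible failures size → δᶜ-sentence l V φ ⟶ 1ℚ
    negligible⇒limit = negligible-complement {δᶜ-sentence l V φ} {failures} {size} (λ n → Measure.size≡ l V n arities (someOutcome n))
      λ n → trans (cong (ℚ._+ ι (failures n) ℚ.* weight n) (δᶜ-uniform n)) (total n)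

  module _ {α k : ℕ} (G : ColourGadgets l V) (𝒜 : Structure V α) (𝓑 : Structure V (α + k)) (1≤k : 1 ≤ k)
           (sub : IsSubstructure 𝒜 𝓑) where
    open ColourGadgets G using (r; 3≤s; 𝒮)
    open Extension l V using (rich?; poor-negligible)

    private
      φ = extensionAxiom G 𝒜 𝓑
      instance
        s≢0 : NonZero (r + 2)
        s≢0 = ℕ.>-nonZero (ℕ.≤-trans (s≤s z≤n) 3≤s)
        β≢0 : NonZero (α + k)
        β≢0 = ℕ.>-nonZero (ℕ.≤-trans 1≤k (ℕ.m≤n+m k α))

    -- The universe has size `suc n`, so that `zero` can serve as the default element of
    -- `rich⇒axiom`.
    failing⇒poor : ∀ {n} (ω : Ω l V (suc n)) → ¬ Models φ (mask ω) →
      ¬ 𝒮-extension.Rich G ω ⊎ ¬ 𝓑-extension.Rich G 𝒜 𝓑 sub ω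
    failing⇒poor ω ¬models with rich? 𝒮 (inner? G) ω | rich? 𝓑 (added? G 𝒜 𝓑 sub) ω
    ... | no ¬rich   | _          = inj₁ ¬rich
    ... | yes _      | no ¬rich   = inj₂ ¬rich
    ... | yes 𝒮-rich | yes 𝓑-rich = contradiction
      (reduct∈𝐂 ω , subst (_⊨ φ) (sym (reduct-coloured (proj₁ ω) (proper ω))) (rich⇒axiom G 𝒜 𝓑 sub ω 𝒮-rich 𝓑-rich zero))
      ¬models

    failures-negligible : Negligible (failures φ) size
    failures-negligible = negligible-+
      (poor-negligible 𝒮 (inner? G) size>0)
      (poor-negligible 𝓑 (added? G 𝒜 𝓑 sub) size>0)
      λ { (suc n) _ → #-union (¬? ∘ models? φ ∘ mask) (¬? ∘ rich? 𝒮 (inner? G)) (¬? ∘ rich? 𝓑 (added? G 𝒜 𝓑 sub))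
            failing⇒poor (outcomes l V (suc n)) }

corollary9p13 : (l : ℕ) → 2 ≤ l →
    (V : Vocabulary) → V ≢ [] → All (2 ≤_) V →
    (G : ColourGadgets l V) →
    ∀ φ → IsExtensionAxiom G φ →
    δᶜ-sentence l V φ ⟶ 1ℚ
-- `2 ≤ l` excludes `l = 0`, so `zero` is a colour.
corollary9p13 (suc l) _ V _ arities G _ (extension 𝒜 𝓑 1≤k _ sub) =
  negligible⇒limit (suc l) V arities zero (extensionAxiom G 𝒜 𝓑)
    (failures-negligible (suc l) V arities zero G 𝒜 𝓑 1≤k sub)
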